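{- For every $\varepsilon>0$ there is a positive constant $c_1(\varepsilon)$, depending only on $\varepsilon$, such that for any positive integers $n$ and $\ell$ (for which $u_\ell(n)$ is defined) $$u_{\ell}(n)\geq\begin{cases} c_1(\varepsilon)\,n^{\frac{1}{2}-\varepsilon}\,\ell&\text{for }\;\ell\leq n^{\frac{1}{2}-\varepsilon},\\ c_1(\varepsilon)\,\ell^2&\text{for }\; n^{\frac{1}{2}-\varepsilon}\leq\ell\leq n^{1-\varepsilon},\\ c_1(\varepsilon)\, n^{1-\varepsilon}\,\ell&\text{for }\; n^{1-\varepsilon}\leq\ell.\end{cases}$$
   Context: For integers $n>1$ and $\ell>1$, $u_{\ell}(n)$ denotes the minimum possible cardinality of a union of $n$ arithmetic progressions (of integers), each of length $\ell$, with pairwise distinct differences. An arithmetic progression of length $\ell$ with difference $b$ is a set $\{a+(j-1)b : j=1,\dots,\ell\}$. -}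

module Defs where

open import Data.Nat using (ℕ; _≤_; _*_; _^_)
open import Data.Integer as ℤ using (ℤ; +_)
open import Data.Fin using (Fin; toℕ)
open import Data.List using (List; map; upTo; length; deduplicate; concatMap; allFin)
open import Data.Product using (_×_; proj₁; proj₂)
open import Relation.Binary.PropositionalEquality using (_≡_)

AP : ℤ → ℤ → ℕ → List ℤ
AP a b ℓ = map (λ j → a ℤ.+ (+ j) ℤ.* b) (upTo ℓ)

-- A family of n progressions, given by (first term, difference).
Family : ℕ → Set
Family n = Fin n → ℤ × ℤ

DistinctDiffs : ∀ {n} → Family n → Set
DistinctDiffs {n} F = ∀ (i j : Fin n) → proj₂ (F i) ≡ proj₂ (F j) → i ≡ j

unionList : ∀ {n} → Family n → ℕ → List ℤ
unionList {n} F ℓ = concatMap (λ i → AP (proj₁ (F i)) (proj₂ (F i)) ℓ) (allFin n)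

unionCard : ∀ {n} → Family n → ℕ → ℕ
unionCard F ℓ = length (deduplicate ℤ._≟_ (unionList F ℓ))

-- "u_ℓ(n) ≥ k": every admissible union has at least k elements
-- (equivalent to the minimum being ≥ k).
uAtLeast : ℕ → ℕ → ℕ → Set
uAtLeast ℓ n k = ∀ (F : Family n) → DistinctDiffs F → k ≤ unionCard F ℓ

uPowAtLeast : ℕ → ℕ → ℕ → ℕ → ℕ → Set
uPowAtLeast ℓ n D t k = ∀ (F : Family n) → DistinctDiffs F → k ≤ (unionCard F ℓ ^ D) * t

{-# OPTIONS --safe #-}
module Submission where

-- Let e₁, …, eₙ be the absolute values of the differences, after passing to a subfamily with nonzero
-- differences of one sign. By Cauchy–Schwarz the union U is large as soon as the
-- progressions have few coincidences, and these are controlled by the multiplicative energy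
-- E(N) = #{(i, k, x, y) : x, y ≤ N, x eᵢ = y eₖ}: counting coinciding points gives
-- n²ℓ² ≪ |U| (ℓ/N) (n² + E(N)), and counting coinciding pairs of points gives n²N³ ≪ |U|² E(N) for
-- N ≤ ℓ/2. To bound E(N), view it as the sum of the entries of a symmetric n × n matrix. The entries
-- of its m-th power (m a power of 2) count solutions of x₁⋯xₘ eᵢ = y₁⋯yₘ eₖ, because the eⱼ are
-- distinct; choosing the y's leaves at most C N choices of the x's by the divisor bound
-- τ(v) ≪ v^(1/m²). Cauchy–Schwarz for powers of the matrix then gives E(N)^m ≤ C (nN)^(m+1), which
-- is E(N) ≪ (nN)^(1+ε) for large m.

open import Defs
open import Data.Nat.Base
open import Data.Nat.Properties
open import Data.Nat.Divisibility
open import Data.Nat.DivMod using (m≡m%n+[m/n]*n; m/n*n≤m; m%n<n)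
open import Data.Nat.Coprimality using (Coprime; coprime-divisor)
open import Data.Nat.Primality
open import Data.Nat.Primality.Factorisation using (factorise; module PrimeFactorisation)
open import Data.Nat.ListAction using (product)
open import Data.Nat.ListAction.Properties using (∈⇒∣product)
open import Data.Nat.Induction using (<-wellFounded; Acc; acc)
open import Data.Nat.Tactic.RingSolver using (solve-∀)
open import Data.Integer.Base as ℤ using (ℤ; -[1+_]; ∣_∣; 0ℤ; 1ℤ; -1ℤ)
import Data.Integer.Properties as ℤ
import Data.Integer.Tactic.RingSolver as ℤ-Solver
open import Algebra.Properties.AbelianGroup ℤ.+-0-abelianGroup using () renaming (∙-cancelˡ to ℤ-+-cancelˡ)
open import Data.Fin.Base using (Fin; zero; suc)
open import Data.Fin.Properties using (injective⇒≤)
open import Data.List.Base using (List; []; _∷_; _++_; map; length; filter; lookup; deduplicate; allFin; applyUpTo; upTo; cartesianProduct; cartesianProductWith)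
open import Data.List.Properties using (length-applyUpTo; length-upTo; length-tabulate)
open import Data.List.Membership.Propositional using (_∈_; find; lose)
open import Data.List.Membership.Propositional.Properties
  using (∈-applyUpTo⁺; ∈-applyUpTo⁻; ∈-upTo⁺; ∈-upTo⁻; ∈-allFin; ∈-lookup; ∈-filter⁻; ∈-map⁺; ∈-concatMap⁺;
         ∈-deduplicate⁺; ∈-cartesianProductWith⁻; ∈-cartesianProduct⁺; ∈-cartesianProduct⁻)
open import Data.List.Relation.Unary.Any using (here; there; any?)
open import Data.List.Relation.Unary.All as All using (All; []; _∷_)
open import Data.List.Relation.Unary.AllPairs using ([]; _∷_)
open import Data.List.Relation.Unary.Unique.Propositional using (Unique)
open import Data.List.Relation.Unary.Unique.Propositional.Properties
  using (applyUpTo⁺₁; upTo⁺; allFin⁺; filter⁺; cartesianProduct⁺)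
open import Data.List.Relation.Unary.Unique.DecPropositional.Properties ℤ._≟_ using (deduplicate-!)
open import Data.Product.Base using (Σ; ∃; ∃₂; _×_; _,_; proj₁; proj₂)
open import Data.Product.Properties using (≡-dec)
open import Data.Sum.Base using (_⊎_; inj₁; inj₂)
open import Relation.Binary.Definitions using (DecidableEquality)
open import Relation.Binary.PropositionalEquality hiding (J)
open import Relation.Nullary using (Dec; yes; no; contradiction; _×-dec_)

-- Finite sums and the collision inequality

-- The trivial solutions i = k, x = y already give E(N) ≥ nN, so the energy bound is sharp up to ε,
-- and all depends on how it is spent. Because of its n² term, the count of points gives at most |U|
-- ≫ Nℓ ≤ ℓ². For ℓ below n^(1/2) this is less than n^(1/2) ℓ, which is why short progressions need
-- the count of pairs. For long progressions the blocks have N = min(n, ℓ) terms: up to N = n the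
-- energy stays near n², the size of the term that is present anyway. With ε = p/q, the bound E(N) ≪
-- (nN)^(1+1/m) for N ≤ n loses at most n^(2/m), and this is at most n^(1/q) ≤ n^ε as soon as m ≥
-- 2q. The value m = 2^(2q) satisfies this and suits the repeated squaring of the matrix. One sign
-- for all differences makes the common points of two progressions appear in the same order in both,
-- so index distances are positive on both sides and are exactly what E(N) counts.

∑ : ∀ {a} {A : Set a} → List A → (A → ℕ) → ℕ
∑ []       f = 0
∑ (x ∷ xs) f = f x + ∑ xs f

infixr 8 ∑
syntax ∑ xs (λ x → e) = ∑[ x ∈ xs ] e

-- The Iverson bracket. Every cardinality to be estimated is a sum of brackets, so that double
-- counting becomes `∑-swap`.
⟦_⟧ : ∀ {p} {P : Set p} → Dec P → ℕ
⟦ yes _ ⟧ = 1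
⟦ no  _ ⟧ = 0

⟦⟧-yes : ∀ {p} {P : Set p} (P? : Dec P) → P → ⟦ P? ⟧ ≡ 1
⟦⟧-yes (yes _) _ = refl
⟦⟧-yes (no ¬p) p = contradiction p ¬p

⟦⟧-mono : ∀ {p q} {P : Set p} {Q : Set q} (P? : Dec P) (Q? : Dec Q) → (P → Q) → ⟦ P? ⟧ ≤ ⟦ Q? ⟧
⟦⟧-mono (no _)  Q? f = z≤n
⟦⟧-mono (yes p) Q? f = ≤-reflexive (sym (⟦⟧-yes Q? (f p)))

⟦⟧-≤ : ∀ {p} {P : Set p} (P? : Dec P) {n : ℕ} → (P → 1 ≤ n) → ⟦ P? ⟧ ≤ n
⟦⟧-≤ (no _)  f = z≤n
⟦⟧-≤ (yes p) f = f p

⟦⟧*-≤ : ∀ {p} {P : Set p} (P? : Dec P) {m n : ℕ} → (P → m ≤ n) → ⟦ P? ⟧ * m ≤ n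
⟦⟧*-≤ (no _)  f = z≤n
⟦⟧*-≤ (yes p) {m} f = ≤-trans (≤-reflexive (*-identityˡ m)) (f p)

module _ {a} {A : Set a} where

  ∑-mono-∈ : ∀ (xs : List A) {f g} → (∀ {x} → x ∈ xs → f x ≤ g x) → ∑ xs f ≤ ∑ xs g
  ∑-mono-∈ []       f≤g = z≤n
  ∑-mono-∈ (x ∷ xs) f≤g = +-mono-≤ (f≤g (here refl)) (∑-mono-∈ xs λ i → f≤g (there i))

  ∑-mono : ∀ (xs : List A) {f g} → (∀ x → f x ≤ g x) → ∑ xs f ≤ ∑ xs g
  ∑-mono xs f≤g = ∑-mono-∈ xs λ {x} _ → f≤g x

  ∑-cong : ∀ (xs : List A) {f g} → (∀ x → f x ≡ g x) → ∑ xs f ≡ ∑ xs g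
  ∑-cong []       f≡g = refl
  ∑-cong (x ∷ xs) f≡g = cong₂ _+_ (f≡g x) (∑-cong xs f≡g)

  ∑-+ : ∀ (xs : List A) f g → ∑[ x ∈ xs ] (f x + g x) ≡ ∑ xs f + ∑ xs g
  ∑-+ []       f g = refl
  ∑-+ (x ∷ xs) f g = trans (cong (f x + g x +_) (∑-+ xs f g)) (interchange (f x) (g x) (∑ xs f) (∑ xs g))
    where
    interchange : ∀ a b c d → a + b + (c + d) ≡ a + c + (b + d)
    interchange = solve-∀

  ∑-*ˡ : ∀ (xs : List A) c f → ∑[ x ∈ xs ] (c * f x) ≡ c * ∑ xs f
  ∑-*ˡ []       c f = sym (*-zeroʳ c)
  ∑-*ˡ (x ∷ xs) c f = trans (cong (c * f x +_) (∑-*ˡ xs c f)) (sym (*-distribˡ-+ c (f x) (∑ xs f)))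

  ∑-*ʳ : ∀ (xs : List A) c f → ∑[ x ∈ xs ] (f x * c) ≡ ∑ xs f * c
  ∑-*ʳ xs c f = trans (∑-cong xs λ x → *-comm (f x) c) (trans (∑-*ˡ xs c f) (*-comm c (∑ xs f)))

  ∑-const : ∀ (xs : List A) c → ∑[ x ∈ xs ] c ≡ length xs * c
  ∑-const []       c = refl
  ∑-const (x ∷ xs) c = cong (c +_) (∑-const xs c)

  ∑-≤-const : ∀ (xs : List A) {f c} → (∀ {x} → x ∈ xs → f x ≤ c) → ∑ xs f ≤ length xs * c
  ∑-≤-const xs {c = c} f≤c = ≤-trans (∑-mono-∈ xs f≤c) (≤-reflexive (∑-const xs c))

  ∑-++ : ∀ (xs ys : List A) f → ∑ (xs ++ ys) f ≡ ∑ xs f + ∑ ys f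
  ∑-++ []       ys f = refl
  ∑-++ (x ∷ xs) ys f = trans (cong (f x +_) (∑-++ xs ys f)) (sym (+-assoc (f x) (∑ xs f) (∑ ys f)))

  f≤∑ : ∀ {xs : List A} f {x} → x ∈ xs → f x ≤ ∑ xs f
  f≤∑ f (here refl) = m≤m+n _ _
  f≤∑ f (there i)   = ≤-trans (f≤∑ f i) (m≤n+m _ _)

  ∑-unique-≤1 : ∀ {p} {P : A → Set p} (P? : ∀ x → Dec (P x)) {xs} → Unique xs →
                (∀ {x y} → x ∈ xs → y ∈ xs → P x → P y → x ≡ y) → ∑[ x ∈ xs ] ⟦ P? x ⟧ ≤ 1
  ∑-unique-≤1 P? []            unique = z≤n
  ∑-unique-≤1 P? {x ∷ xs} (x∉ ∷ xs!) unique with P? x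
  ... | no  _ = ∑-unique-≤1 P? xs! λ i j → unique (there i) (there j)
  ... | yes p = ≤-reflexive (cong suc (n≤0⇒n≡0
      (≤-trans (∑-≤-const xs λ {y} i → ⟦⟧-≤ (P? y) λ q → contradiction (unique (here refl) (there i) p q) (All.lookup x∉ i))
               (≤-reflexive (*-zeroʳ (length xs))))))

∑-swap : ∀ {a b} {A : Set a} {B : Set b} (xs : List A) (ys : List B) (f : A → B → ℕ) →
         ∑[ x ∈ xs ] ∑[ y ∈ ys ] f x y ≡ ∑[ y ∈ ys ] ∑[ x ∈ xs ] f x y
∑-swap []       ys f = sym (trans (∑-const ys 0) (*-zeroʳ (length ys)))
∑-swap (x ∷ xs) ys f = trans (cong (∑ ys (f x) +_) (∑-swap xs ys f)) (sym (∑-+ ys (f x) _))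

∑-map : ∀ {a b} {A : Set a} {B : Set b} (g : A → B) (xs : List A) f → ∑ (map g xs) f ≡ ∑[ x ∈ xs ] f (g x)
∑-map g []       f = refl
∑-map g (x ∷ xs) f = cong (f (g x) +_) (∑-map g xs f)

∑-product : ∀ {a b c} {A : Set a} {B : Set b} {C : Set c} (g : A → B → C) xs ys f →
            ∑ (cartesianProductWith g xs ys) f ≡ ∑[ x ∈ xs ] ∑[ y ∈ ys ] f (g x y)
∑-product g []       ys f = refl
∑-product g (x ∷ xs) ys f = trans (∑-++ (map (g x) ys) _ f) (cong₂ _+_ (∑-map (g x) ys f) (∑-product g xs ys f))

∑-*-∑ : ∀ {a b} {A : Set a} {B : Set b} (xs : List A) (ys : List B) f g →
        ∑ xs f * ∑ ys g ≡ ∑[ x ∈ xs ] ∑[ y ∈ ys ] (f x * g y)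
∑-*-∑ xs ys f g = trans (sym (∑-*ʳ xs (∑ ys g) f)) (∑-cong xs λ x → sym (∑-*ˡ ys (f x) g))

2mn≤m²+n² : ∀ m n → 2 * (m * n) ≤ m * m + n * n
2mn≤m²+n² zero    n       = z≤n
2mn≤m²+n² (suc m) zero    = ≤-trans (≤-reflexive (cong (2 *_) (*-zeroʳ m))) z≤n
2mn≤m²+n² (suc m) (suc n) = subst₂ _≤_ (lhs m n) (rhs m n) (+-monoˡ-≤ (2 + 2 * m + 2 * n) (2mn≤m²+n² m n))
  where
  lhs : ∀ m n → 2 * (m * n) + (2 + 2 * m + 2 * n) ≡ 2 * (suc m * suc n)
  lhs = solve-∀
  rhs : ∀ m n → m * m + n * n + (2 + 2 * m + 2 * n) ≡ suc m * suc m + suc n * suc n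
  rhs = solve-∀

cauchy-schwarz : ∀ {a} {A : Set a} (xs : List A) f →
                 ∑ xs f * ∑ xs f ≤ length xs * ∑[ x ∈ xs ] (f x * f x)
cauchy-schwarz []       f = z≤n
cauchy-schwarz (x ∷ xs) f = begin
  (c + F) * (c + F)                     ≡⟨ expand c F ⟩
  c * c + (2 * (c * F) + F * F)         ≤⟨ +-monoʳ-≤ (c * c) (+-mono-≤ (cross xs) (cauchy-schwarz xs f)) ⟩
  c * c + (L * (c * c) + G + L * G)     ≡⟨ collect c L G ⟩
  suc L * (c * c + G)                   ∎
  where
  open ≤-Reasoning
  c = f x
  F = ∑ xs f
  G = ∑[ x ∈ xs ] (f x * f x)
  L = length xs
  expand : ∀ c F → (c + F) * (c + F) ≡ c * c + (2 * (c * F) + F * F)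
  expand = solve-∀
  collect : ∀ c L G → c * c + (L * (c * c) + G + L * G) ≡ suc L * (c * c + G)
  collect = solve-∀
  cross : ∀ ys → 2 * (c * ∑ ys f) ≤ length ys * (c * c) + ∑[ y ∈ ys ] (f y * f y)
  cross ys = begin
    2 * (c * ∑ ys f)                       ≡⟨ cong (2 *_) (∑-*ˡ ys c f) ⟨
    2 * ∑[ y ∈ ys ] (c * f y)              ≡⟨ ∑-*ˡ ys 2 _ ⟨
    ∑[ y ∈ ys ] (2 * (c * f y))            ≤⟨ ∑-mono ys (λ y → 2mn≤m²+n² c (f y)) ⟩
    ∑[ y ∈ ys ] (c * c + f y * f y)        ≡⟨ ∑-+ ys _ _ ⟩
    ∑[ y ∈ ys ] (c * c) + ∑[ y ∈ ys ] (f y * f y) ≡⟨ cong (_+ ∑[ y ∈ ys ] (f y * f y)) (∑-const ys (c * c)) ⟩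
    length ys * (c * c) + ∑[ y ∈ ys ] (f y * f y) ∎

-- Cauchy-Schwarz for the sizes `c y` of the fibres of `φ`: they add up to at least `length xs`, and
-- their squares to at most the number of pairs with equal image. Few coincidences therefore force a
-- long `ys`.
collisions : ∀ {a b} {A : Set a} {B : Set b} (_≟ᴮ_ : DecidableEquality B)
             (xs : List A) (ys : List B) (φ : A → B) → Unique ys → (∀ {x} → x ∈ xs → φ x ∈ ys) →
             length xs * length xs ≤ length ys * (∑[ x ∈ xs ] ∑[ x′ ∈ xs ] ⟦ φ x ≟ᴮ φ x′ ⟧)
collisions _≟ᴮ_ xs ys φ ys! φ∈ = begin
  length xs * length xs                                  ≤⟨ *-mono-≤ covered covered ⟩
  ∑ ys c * ∑ ys c                                        ≤⟨ cauchy-schwarz ys c ⟩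
  length ys * (∑[ y ∈ ys ] (c y * c y))                  ≤⟨ *-monoʳ-≤ (length ys) pairs ⟩
  length ys * (∑[ x ∈ xs ] ∑[ x′ ∈ xs ] ⟦ φ x ≟ᴮ φ x′ ⟧) ∎
  where
  open ≤-Reasoning
  c = λ y → ∑[ x ∈ xs ] ⟦ φ x ≟ᴮ y ⟧
  covered : length xs ≤ ∑ ys c
  covered = begin
    length xs                              ≡⟨ *-identityʳ (length xs) ⟨
    length xs * 1                          ≡⟨ ∑-const xs 1 ⟨
    ∑[ x ∈ xs ] 1                          ≤⟨ ∑-mono-∈ xs (λ {x} i → ≤-trans (≤-reflexive (sym (⟦⟧-yes (φ x ≟ᴮ φ x) refl)))
                                                                            (f≤∑ (λ y → ⟦ φ x ≟ᴮ y ⟧) (φ∈ i))) ⟩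
    ∑[ x ∈ xs ] ∑[ y ∈ ys ] ⟦ φ x ≟ᴮ y ⟧   ≡⟨ ∑-swap xs ys _ ⟩
    ∑ ys c                                 ∎
  pairs : ∑[ y ∈ ys ] (c y * c y) ≤ ∑[ x ∈ xs ] ∑[ x′ ∈ xs ] ⟦ φ x ≟ᴮ φ x′ ⟧
  pairs = begin
    ∑[ y ∈ ys ] (c y * c y)
      ≡⟨ ∑-cong ys (λ y → ∑-*-∑ xs xs _ _) ⟩
    ∑[ y ∈ ys ] ∑[ x ∈ xs ] ∑[ x′ ∈ xs ] (⟦ φ x ≟ᴮ y ⟧ * ⟦ φ x′ ≟ᴮ y ⟧)
      ≡⟨ ∑-swap ys xs _ ⟩
    ∑[ x ∈ xs ] ∑[ y ∈ ys ] ∑[ x′ ∈ xs ] (⟦ φ x ≟ᴮ y ⟧ * ⟦ φ x′ ≟ᴮ y ⟧)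
      ≡⟨ ∑-cong xs (λ x → ∑-swap ys xs _) ⟩
    ∑[ x ∈ xs ] ∑[ x′ ∈ xs ] ∑[ y ∈ ys ] (⟦ φ x ≟ᴮ y ⟧ * ⟦ φ x′ ≟ᴮ y ⟧)
      ≤⟨ ∑-mono xs (λ x → ∑-mono xs (λ x′ → single x x′)) ⟩
    ∑[ x ∈ xs ] ∑[ x′ ∈ xs ] ⟦ φ x ≟ᴮ φ x′ ⟧ ∎
    where
    single : ∀ x x′ → ∑[ y ∈ ys ] (⟦ φ x ≟ᴮ y ⟧ * ⟦ φ x′ ≟ᴮ y ⟧) ≤ ⟦ φ x ≟ᴮ φ x′ ⟧
    single x x′ = begin
      ∑[ y ∈ ys ] (⟦ φ x ≟ᴮ y ⟧ * ⟦ φ x′ ≟ᴮ y ⟧)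
        ≤⟨ ∑-mono ys (λ y → ⟦⟧*-≤ (φ x ≟ᴮ y) λ { refl → ≤-trans (⟦⟧-mono (φ x′ ≟ᴮ y) (φ x ≟ᴮ φ x′) sym)
             (≤-reflexive (sym (trans (cong (⟦ φ x ≟ᴮ φ x′ ⟧ *_) (⟦⟧-yes (φ x ≟ᴮ y) refl)) (*-identityʳ _)))) }) ⟩
      ∑[ y ∈ ys ] (⟦ φ x ≟ᴮ φ x′ ⟧ * ⟦ φ x ≟ᴮ y ⟧)
        ≡⟨ ∑-*ˡ ys ⟦ φ x ≟ᴮ φ x′ ⟧ _ ⟩
      ⟦ φ x ≟ᴮ φ x′ ⟧ * ∑[ y ∈ ys ] ⟦ φ x ≟ᴮ y ⟧
        ≤⟨ *-monoʳ-≤ ⟦ φ x ≟ᴮ φ x′ ⟧ (∑-unique-≤1 (φ x ≟ᴮ_) ys! (λ _ _ p q → trans (sym p) q)) ⟩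
      ⟦ φ x ≟ᴮ φ x′ ⟧ * 1
        ≡⟨ *-identityʳ _ ⟩
      ⟦ φ x ≟ᴮ φ x′ ⟧ ∎

-- The divisor bound

[1‥_] : ℕ → List ℕ
[1‥ N ] = applyUpTo suc N

module _ {N : ℕ} where

  ∈[1‥]⁺ : ∀ {x} → 1 ≤ x → x ≤ N → x ∈ [1‥ N ]
  ∈[1‥]⁺ (s≤s _) x≤N = ∈-applyUpTo⁺ suc x≤N

  ∈[1‥]⁻ : ∀ {x} → x ∈ [1‥ N ] → 1 ≤ x × x ≤ N
  ∈[1‥]⁻ i with ∈-applyUpTo⁻ suc i
  ... | _ , k<N , refl = s≤s z≤n , k<N

[1‥]-unique : ∀ N → Unique [1‥ N ]
[1‥]-unique N = applyUpTo⁺₁ suc N λ i<j _ eq → <⇒≢ i<j (suc-injective eq)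

^-distrib-* : ∀ m n k → (m * n) ^ k ≡ m ^ k * n ^ k
^-distrib-* m n zero    = refl
^-distrib-* m n (suc k) = trans (cong (m * n *_) (^-distrib-* m n k)) (rearrange m n (m ^ k) (n ^ k))
  where
  rearrange : ∀ a b c d → a * b * (c * d) ≡ a * c * (b * d)
  rearrange = solve-∀

m≤m*n′ : ∀ m {n} → 1 ≤ n → m ≤ m * n
m≤m*n′ m (s≤s _) = m≤m*n m _

-- Truncated at `N`, the range of the variables in the energy; the bound below is uniform in `N`.
τ : ℕ → ℕ → ℕ
τ N v = ∑[ x ∈ [1‥ N ] ] ⟦ x ∣? v ⟧

prime∤⇒coprime : ∀ {p x} → Prime p → p ∤ x → Coprime x p
prime∤⇒coprime pr p∤x (d∣x , d∣p) with prime⇒irreducible pr d∣p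
... | inj₁ refl = refl
... | inj₂ refl = contradiction d∣x p∤x

∣p^a*w⇒∣w : ∀ {p x} → Prime p → p ∤ x → ∀ a {w} → x ∣ p ^ a * w → x ∣ w
∣p^a*w⇒∣w pr p∤x zero    {w} x∣ = subst (_ ∣_) (*-identityˡ w) x∣
∣p^a*w⇒∣w {p} {x} pr p∤x (suc a) {w} x∣ = ∣p^a*w⇒∣w pr p∤x a
  (coprime-divisor (prime∤⇒coprime pr p∤x) (subst (x ∣_) (*-assoc p (p ^ a) w) x∣))

-- A divisor not divisible by `p` divides `w`. Any other one is `y * p` with `y` dividing
-- `p ^ a * w`; it is determined by `y`, and `y` stays below the truncation.
τ-prime-step : ∀ N {p} → Prime p → ∀ a w → τ N (p ^ suc a * w) ≤ τ N w + τ N (p ^ a * w)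
τ-prime-step N {p} pr a w = begin
  τ N (p ^ suc a * w)
    ≤⟨ ∑-mono-∈ [1‥ N ] (λ {x} i → ⟦⟧-≤ (x ∣? p ^ suc a * w) (pointwise i)) ⟩
  ∑[ x ∈ [1‥ N ] ] (⟦ x ∣? w ⟧ + ∑[ y ∈ [1‥ N ] ] (⟦ y ∣? p ^ a * w ⟧ * ⟦ x ≟ y * p ⟧))
    ≡⟨ ∑-+ [1‥ N ] _ _ ⟩
  τ N w + (∑[ x ∈ [1‥ N ] ] ∑[ y ∈ [1‥ N ] ] (⟦ y ∣? p ^ a * w ⟧ * ⟦ x ≟ y * p ⟧))
    ≡⟨ cong (τ N w +_) (∑-swap [1‥ N ] [1‥ N ] _) ⟩
  τ N w + (∑[ y ∈ [1‥ N ] ] ∑[ x ∈ [1‥ N ] ] (⟦ y ∣? p ^ a * w ⟧ * ⟦ x ≟ y * p ⟧))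
    ≤⟨ +-monoʳ-≤ (τ N w) (∑-mono [1‥ N ] λ y → ≤-trans (≤-reflexive (∑-*ˡ [1‥ N ] ⟦ y ∣? p ^ a * w ⟧ _))
         (≤-trans (*-monoʳ-≤ ⟦ y ∣? p ^ a * w ⟧ (∑-unique-≤1 (λ x → x ≟ y * p) ([1‥]-unique N) (λ _ _ q r → trans q (sym r))))
                  (≤-reflexive (*-identityʳ _)))) ⟩
  τ N w + τ N (p ^ a * w) ∎
  where
  open ≤-Reasoning
  instance _ = prime⇒nonZero pr
  pointwise : ∀ {x} → x ∈ [1‥ N ] → x ∣ p ^ suc a * w →
              1 ≤ ⟦ x ∣? w ⟧ + ∑[ y ∈ [1‥ N ] ] (⟦ y ∣? p ^ a * w ⟧ * ⟦ x ≟ y * p ⟧)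
  pointwise {x} i x∣ with p ∣? x
  ... | no p∤x = m≤n⇒m≤n+o _ (≤-reflexive (sym (⟦⟧-yes (x ∣? w) (∣p^a*w⇒∣w pr p∤x (suc a) x∣))))
  ... | yes (divides y refl) = m≤n⇒m≤o+n _ (≤-trans
          (≤-reflexive (sym (cong₂ _*_ (⟦⟧-yes (y ∣? p ^ a * w) y∣) (⟦⟧-yes (y * p ≟ y * p) refl))))
          (f≤∑ _ y∈))
    where
    y∣ : y ∣ p ^ a * w
    y∣ = *-cancelʳ-∣ p (subst (y * p ∣_) (trans (*-assoc p (p ^ a) w) (*-comm p _)) x∣)
    y∈ : y ∈ [1‥ N ]
    y∈ = ∈[1‥]⁺ (n≢0⇒n>0 λ { refl → contradiction (proj₁ (∈[1‥]⁻ i)) λ () })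
                (≤-trans (m≤m*n y p) (proj₂ (∈[1‥]⁻ i)))

τ-prime-power : ∀ N {p} → Prime p → ∀ a w → τ N (p ^ a * w) ≤ suc a * τ N w
τ-prime-power N pr zero    w = ≤-reflexive (trans (cong (τ N) (*-identityˡ w)) (sym (*-identityˡ _)))
τ-prime-power N pr (suc a) w = ≤-trans (τ-prime-step N pr a w) (+-monoʳ-≤ (τ N w) (τ-prime-power N pr a w))

τ-one : ∀ N → τ N 1 ≤ 1
τ-one N = ∑-unique-≤1 (_∣? 1) ([1‥]-unique N) λ _ _ x∣1 y∣1 → trans (∣1⇒≡1 x∣1) (sym (∣1⇒≡1 y∣1))

-- Each prime at most doubles the divisor count, hence multiplies its k-th power by at most
-- `2 ^ k ≤ p`.
τ-large-primes : ∀ N k {ps} → All Prime ps → All (2 ^ k ≤_) ps → τ N (product ps) ^ k ≤ product ps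
τ-large-primes N k []         []           = ≤-trans (^-monoˡ-≤ k (τ-one N)) (≤-reflexive (^-zeroˡ k))
τ-large-primes N k {p ∷ ps} (pr ∷ prs) (2^k≤p ∷ ls) = begin
  τ N (p * product ps) ^ k       ≡⟨ cong (λ q → τ N (q * product ps) ^ k) (*-identityʳ p) ⟨
  τ N (p ^ 1 * product ps) ^ k   ≤⟨ ^-monoˡ-≤ k (τ-prime-power N pr 1 (product ps)) ⟩
  (2 * τ N (product ps)) ^ k     ≡⟨ ^-distrib-* 2 _ k ⟩
  2 ^ k * τ N (product ps) ^ k   ≤⟨ *-mono-≤ 2^k≤p (τ-large-primes N k prs ls) ⟩
  p * product ps                 ∎
  where open ≤-Reasoning

suc≤2^ : ∀ n → suc n ≤ 2 ^ n
suc≤2^ zero    = ≤-refl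
suc≤2^ (suc n) = ≤-trans (+-mono-≤ (m^n>0 2 n) (suc≤2^ n)) (≤-reflexive (cong (2 ^ n +_) (sym (+-identityʳ _))))

-- From `suc a ≤ k * suc (a / k) ≤ k * 2 ^ (a / k)`; after taking k-th powers the exponent `a / k *
-- k` is at most `a`.
suc^≤2^ : ∀ k .{{_ : NonZero k}} a → suc a ^ k ≤ k ^ k * 2 ^ a
suc^≤2^ k a = begin
  suc a ^ k              ≤⟨ ^-monoˡ-≤ k suc-a≤ ⟩
  (k * 2 ^ (a / k)) ^ k  ≡⟨ ^-distrib-* k _ k ⟩
  k ^ k * (2 ^ (a / k)) ^ k  ≡⟨ cong (k ^ k *_) (^-*-assoc 2 (a / k) k) ⟩
  k ^ k * 2 ^ (a / k * k)    ≤⟨ *-monoʳ-≤ (k ^ k) (^-monoʳ-≤ 2 (≤-trans (m≤n+m (a / k * k) (a % k)) (≤-reflexive (sym (m≡m%n+[m/n]*n a k))))) ⟩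
  k ^ k * 2 ^ a          ∎
  where
  open ≤-Reasoning
  suc-a≤ : suc a ≤ k * 2 ^ (a / k)
  suc-a≤ = begin
    suc a                 ≡⟨ cong suc (m≡m%n+[m/n]*n a k) ⟩
    suc (_ + a / k * k)   ≤⟨ +-monoˡ-≤ (a / k * k) (m%n<n a k) ⟩
    k + a / k * k         ≡⟨ *-comm (suc (a / k)) k ⟩
    k * suc (a / k)       ≤⟨ *-monoʳ-≤ k (suc≤2^ (a / k)) ⟩
    k * 2 ^ (a / k)       ∎

extract-power : ∀ t → 2 ≤ t → ∀ v → 1 ≤ v → ∃₂ λ a w → v ≡ t ^ a * w × 1 ≤ w × t ∤ w
extract-power t 2≤t v 1≤v = go v 1≤v (<-wellFounded v)
  where
  go : ∀ v → 1 ≤ v → Acc _<_ v → ∃₂ λ a w → v ≡ t ^ a * w × 1 ≤ w × t ∤ w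
  go v 1≤v (acc rec) with t ∣? v
  ... | no t∤v = 0 , v , sym (*-identityˡ v) , 1≤v , t∤v
  ... | yes (divides zero refl) = contradiction 1≤v λ ()
  ... | yes (divides u@(suc _) refl) with go u (s≤s z≤n) (rec (m<m*n u t 2≤t))
  ...   | a , w , u≡ , 1≤w , t∤w = suc a , w , trans (cong (_* t) u≡) (rearrange (t ^ a) w t) , 1≤w , t∤w
    where
    rearrange : ∀ a b c → a * b * c ≡ c * a * b
    rearrange = solve-∀

-- Descending induction on the least possible prime factor t: each prime below 2 ^ k costs a factor
-- k ^ k, and the primes above 2 ^ k cost nothing.
τ-rough : ∀ N k .{{_ : NonZero k}} g t → t + g ≡ 2 ^ k → 2 ≤ t → ∀ v → 1 ≤ v → t Rough v →
          τ N v ^ k ≤ (k ^ k) ^ g * v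
-- Now `t` equals `2 ^ k`, so roughness places all prime factors of `v` in the scope of
-- `τ-large-primes`.
τ-rough N k zero t t≡ 2≤t v@(suc _) _ rough = ≤-trans
  (subst (λ u → τ N u ^ k ≤ u) (sym isFactorisation) (τ-large-primes N k factorsPrime
    (All.tabulate λ {p} p∈ → subst (_≤ p) (trans (sym (+-identityʳ t)) t≡)
      (rough⇒≤ {{prime⇒nonTrivial (All.lookup factorsPrime p∈)}}
        (rough∧∣⇒rough rough (subst (p ∣_) (sym isFactorisation) (∈⇒∣product p∈)))))))
  (≤-reflexive (sym (*-identityˡ v)))
  where open PrimeFactorisation (factorise v)
τ-rough N k (suc g) t t≡ 2≤t v 1≤v rough with t ∣? v
... | no t∤v = ≤-trans
        (τ-rough N k g (suc t) (trans (sym (+-suc t g)) t≡) (m≤n⇒m≤1+n 2≤t) v 1≤v (∤⇒rough-suc t∤v rough))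
        (*-monoˡ-≤ v (m≤n*m ((k ^ k) ^ g) (k ^ k) {{m^n≢0 k k}}))
... | yes t∣v with extract-power t 2≤t v 1≤v
...   | a , w , refl , 1≤w , t∤w = begin
  τ N (t ^ a * w) ^ k                       ≤⟨ ^-monoˡ-≤ k (τ-prime-power N t-prime a w) ⟩
  -- Since `2 ≤ t`, the `2 ^ a` of `suc^≤2^` is paid for by the factor `t ^ a` of `v`, and only
  -- `k ^ k` is lost.
  (suc a * τ N w) ^ k                       ≡⟨ ^-distrib-* (suc a) (τ N w) k ⟩
  suc a ^ k * τ N w ^ k                     ≤⟨ *-mono-≤ (≤-trans (suc^≤2^ k a) (*-monoʳ-≤ (k ^ k) (^-monoˡ-≤ a 2≤t)))
                                                 (τ-rough N k g (suc t) (trans (sym (+-suc t g)) t≡) (m≤n⇒m≤1+n 2≤t) w 1≤w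
                                                   (∤⇒rough-suc t∤w (rough∧∣⇒rough rough (n∣m*n (t ^ a))))) ⟩
  k ^ k * t ^ a * ((k ^ k) ^ g * w)         ≡⟨ rearrange (k ^ k) (t ^ a) ((k ^ k) ^ g) w ⟩
  (k ^ k) ^ suc g * (t ^ a * w)             ∎
  where
  open ≤-Reasoning
  t-prime : Prime t
  t-prime = rough∧∣⇒prime {{n>1⇒nonTrivial 2≤t}} rough t∣v
  rearrange : ∀ a b c d → a * b * (c * d) ≡ a * c * (b * d)
  rearrange = solve-∀

divisor-bound : ∀ k .{{_ : NonZero k}} → ∃ λ C → 1 ≤ C × (∀ N v → 1 ≤ v → τ N v ^ k ≤ C * v)
-- One factor `k ^ k` for each `t` from 2 to `2 ^ k - 1`; the induction can start at 2 because every
-- number is 2-rough.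
divisor-bound k@(suc k-1) = (k ^ k) ^ g , m^n>0 (k ^ k) {{m^n≢0 k k}} g ,
  λ N v 1≤v → τ-rough N k g 2 (m+[n∸m]≡n (*-monoʳ-≤ 2 (m^n>0 2 k-1))) ≤-refl v 1≤v 2-rough
  where
  g = 2 ^ k ∸ 2

-- Multiplicative energy

^-cancelˡ-≤ : ∀ k .{{_ : NonZero k}} {m n} → m ^ k ≤ n ^ k → m ≤ n
^-cancelˡ-≤ k m^k≤n^k = ≮⇒≥ λ n<m → <⇒≱ (^-monoˡ-< k n<m) m^k≤n^k

length-product : ∀ {a b c} {A : Set a} {B : Set b} {C : Set c} (g : A → B → C) xs ys →
                 length (cartesianProductWith g xs ys) ≡ length xs * length ys
length-product g xs ys = begin
  length (cartesianProductWith g xs ys)       ≡⟨ count (cartesianProductWith g xs ys) ⟩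
  ∑[ z ∈ cartesianProductWith g xs ys ] 1     ≡⟨ ∑-product g xs ys _ ⟩
  ∑[ x ∈ xs ] ∑[ y ∈ ys ] 1                   ≡⟨ ∑-cong xs (λ _ → sym (count ys)) ⟩
  ∑[ x ∈ xs ] length ys                       ≡⟨ ∑-const xs (length ys) ⟩
  length xs * length ys                       ∎
  where
  open ≡-Reasoning
  count : ∀ {a} {A : Set a} (zs : List A) → length zs ≡ ∑[ z ∈ zs ] 1
  count zs = sym (trans (∑-const zs 1) (*-identityʳ _))

-- The products of `2 ^ h` factors from `[1‥ N ]`, with repetitions: an entry stands for a tuple of
-- factors, so counting entries equal to `v` counts factorisations. Doubling the number of factors
-- matches squaring the matrix.
products : ℕ → ℕ → List ℕ
products N zero    = [1‥ N ]
products N (suc h) = cartesianProductWith _*_ (products N h) (products N h)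

2^suc : ∀ h → 2 ^ suc h ≡ 2 ^ h + 2 ^ h
2^suc h = cong (2 ^ h +_) (+-identityʳ (2 ^ h))

^-2^suc : ∀ x h → x ^ 2 ^ suc h ≡ x ^ 2 ^ h * x ^ 2 ^ h
^-2^suc x h = trans (cong (x ^_) (2^suc h)) (^-distribˡ-+-* x (2 ^ h) (2 ^ h))

length-products : ∀ N h → length (products N h) ≡ N ^ 2 ^ h
length-products N zero    = trans (length-applyUpTo suc N) (sym (*-identityʳ N))
length-products N (suc h) = trans (length-product _*_ (products N h) (products N h))
  (trans (cong₂ _*_ (length-products N h) (length-products N h)) (sym (^-2^suc N h)))

products-bounds : ∀ N h {x} → x ∈ products N h → 1 ≤ x × x ≤ N ^ 2 ^ h
products-bounds N zero    i with ∈[1‥]⁻ i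
... | 1≤x , x≤N = 1≤x , ≤-trans x≤N (≤-reflexive (sym (*-identityʳ N)))
products-bounds N (suc h) i with ∈-cartesianProductWith⁻ _*_ (products N h) (products N h) i
... | _ , _ , i₁ , i₂ , refl with products-bounds N h i₁ | products-bounds N h i₂
...   | 1≤x , x≤ | 1≤y , y≤ = *-mono-≤ 1≤x 1≤y , ≤-trans (*-mono-≤ x≤ y≤) (≤-reflexive (sym (^-2^suc N h)))

-- If a product divides `v`, so does each of its `2 ^ h` factors.
products-divisors : ∀ N h v → ∑[ x ∈ products N h ] ⟦ x ∣? v ⟧ ≤ τ N v ^ 2 ^ h
products-divisors N zero    v = ≤-reflexive (sym (*-identityʳ _))
products-divisors N (suc h) v = begin
  ∑[ z ∈ products N (suc h) ] ⟦ z ∣? v ⟧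
    ≡⟨ ∑-product _*_ (products N h) (products N h) _ ⟩
  ∑[ x ∈ products N h ] ∑[ y ∈ products N h ] ⟦ x * y ∣? v ⟧
    ≤⟨ ∑-mono (products N h) (λ x → ∑-mono (products N h) λ y → ⟦⟧-≤ (x * y ∣? v) λ xy∣v →
         ≤-reflexive (sym (cong₂ _*_ (⟦⟧-yes (x ∣? v) (m*n∣⇒m∣ x y xy∣v)) (⟦⟧-yes (y ∣? v) (m*n∣⇒n∣ x y xy∣v))))) ⟩
  ∑[ x ∈ products N h ] ∑[ y ∈ products N h ] (⟦ x ∣? v ⟧ * ⟦ y ∣? v ⟧)
    ≡⟨ ∑-*-∑ (products N h) (products N h) _ _ ⟨
  ∑[ x ∈ products N h ] ⟦ x ∣? v ⟧ * ∑[ y ∈ products N h ] ⟦ y ∣? v ⟧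
    ≤⟨ *-mono-≤ (products-divisors N h v) (products-divisors N h v) ⟩
  τ N v ^ 2 ^ h * τ N v ^ 2 ^ h
    ≡⟨ ^-2^suc (τ N v) h ⟨
  τ N v ^ 2 ^ suc h ∎
  where open ≤-Reasoning

-- The exponent (2 ^ h)² in the divisor bound is chosen so that, although v may be
-- as large as N ^ 2 ^ h, a single factor N suffices.
products-multiplicity : ∀ h → ∃ λ C → 1 ≤ C × (∀ N v → ∑[ x ∈ products N h ] ⟦ x ≟ v ⟧ ≤ C * N)
products-multiplicity h = C , 1≤C , bound
  where
  open ≤-Reasoning
  m = 2 ^ h
  instance
    m≢0 : NonZero m
    m≢0 = m^n≢0 2 h
  divisors = divisor-bound (m * m) {{m*n≢0 m m}}
  C = proj₁ divisors
  1≤C = proj₁ (proj₂ divisors)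
  instance
    C≢0 : NonZero C
    C≢0 = >-nonZero 1≤C
  bound : ∀ N v → ∑[ x ∈ products N h ] ⟦ x ≟ v ⟧ ≤ C * N
  bound N v with 1 ≤? v | v ≤? N ^ m
  ... | yes 1≤v | yes v≤ = ^-cancelˡ-≤ m (begin
    (∑[ x ∈ products N h ] ⟦ x ≟ v ⟧) ^ m
      ≤⟨ ^-monoˡ-≤ m (∑-mono (products N h) λ x → ⟦⟧-mono (x ≟ v) (x ∣? v) ∣-reflexive) ⟩
    (∑[ x ∈ products N h ] ⟦ x ∣? v ⟧) ^ m   ≤⟨ ^-monoˡ-≤ m (products-divisors N h v) ⟩
    (τ N v ^ m) ^ m                          ≡⟨ ^-*-assoc (τ N v) m m ⟩
    τ N v ^ (m * m)                          ≤⟨ proj₂ (proj₂ divisors) N v 1≤v ⟩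
    C * v                                    ≤⟨ *-monoʳ-≤ C v≤ ⟩
    C * N ^ m                                ≤⟨ *-monoˡ-≤ (N ^ m) (≤-trans (≤-reflexive (sym (*-identityʳ C))) (^-monoʳ-≤ C (>-nonZero⁻¹ m))) ⟩
    C ^ m * N ^ m                            ≡⟨ ^-distrib-* C N m ⟨
    (C * N) ^ m                              ∎)
  ... | no v≱1 | _ = ≤-trans (∑-≤-const (products N h) λ {x} i → ⟦⟧-≤ (x ≟ v) λ { refl → contradiction (proj₁ (products-bounds N h i)) v≱1 })
                             (≤-trans (≤-reflexive (*-zeroʳ (length (products N h)))) z≤n)
  ... | yes _  | no v≰ = ≤-trans (∑-≤-const (products N h) λ {x} i → ⟦⟧-≤ (x ≟ v) λ { refl → contradiction (proj₂ (products-bounds N h i)) v≰ })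
                             (≤-trans (≤-reflexive (*-zeroʳ (length (products N h)))) z≤n)

module Energy {n : ℕ} (e : Fin n → ℕ) (1≤e : ∀ i → 1 ≤ e i) (e-injective : ∀ {i j} → e i ≡ e j → i ≡ j) where

  open ≤-Reasoning

  I : List (Fin n)
  I = allFin n

  length-I : length I ≡ n
  length-I = length-tabulate (λ i → i)

  -- Entry (i, j) is the number of ways to write the ratio `e j / e i` as `x / y` with `x` and `y`
  -- from `L`.
  ratios : List ℕ → Fin n → Fin n → ℕ
  ratios L i j = ∑[ x ∈ L ] ∑[ y ∈ L ] ⟦ x * e i ≟ y * e j ⟧

  ratios-sym : ∀ L i j → ratios L i j ≡ ratios L j i
  ratios-sym L i j = trans (∑-swap L L _) (∑-cong L λ y → ∑-cong L λ x →
    ≤-antisym (⟦⟧-mono (x * e i ≟ y * e j) (y * e j ≟ x * e i) sym) (⟦⟧-mono (y * e j ≟ x * e i) (x * e i ≟ y * e j) sym))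

  -- Multiplying the two relations eliminates `e j`. For given `x`, `x′`, `y`, `y′` at most one `j`
  -- contributes, because `y * e j ≡ x * e i` fixes `e j`; here the distinctness of the differences
  -- enters the energy bound.
  ratios-step : ∀ L → (∀ {x} → x ∈ L → 1 ≤ x) → ∀ i k →
                ∑[ j ∈ I ] (ratios L i j * ratios L j k) ≤ ratios (cartesianProductWith _*_ L L) i k
  ratios-step L 1≤L i k = begin
    ∑[ j ∈ I ] (ratios L i j * ratios L j k)
      ≡⟨ ∑-cong I (λ j → trans (∑-*-∑ L L _ _) (∑-cong L λ x → ∑-cong L λ x′ → ∑-*-∑ L L _ _)) ⟩
    ∑[ j ∈ I ] ∑[ x ∈ L ] ∑[ x′ ∈ L ] ∑[ y ∈ L ] ∑[ y′ ∈ L ] (⟦ x * e i ≟ y * e j ⟧ * ⟦ x′ * e j ≟ y′ * e k ⟧)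
      ≡⟨ trans (∑-swap I L _) (∑-cong L λ x → trans (∑-swap I L _) (∑-cong L λ x′ →
           trans (∑-swap I L _) (∑-cong L λ y → ∑-swap I L _))) ⟩
    ∑[ x ∈ L ] ∑[ x′ ∈ L ] ∑[ y ∈ L ] ∑[ y′ ∈ L ] ∑[ j ∈ I ] (⟦ x * e i ≟ y * e j ⟧ * ⟦ x′ * e j ≟ y′ * e k ⟧)
      ≤⟨ ∑-mono L (λ x → ∑-mono L λ x′ → ∑-mono-∈ L λ {y} y∈ → ∑-mono L λ y′ → single x x′ y y′ (1≤L y∈)) ⟩
    ∑[ x ∈ L ] ∑[ x′ ∈ L ] ∑[ y ∈ L ] ∑[ y′ ∈ L ] ⟦ x * x′ * e i ≟ y * y′ * e k ⟧
      ≡⟨ trans (∑-product _*_ L L _) (∑-cong L λ x → ∑-cong L λ x′ → ∑-product _*_ L L _) ⟨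
    ratios (cartesianProductWith _*_ L L) i k ∎
    where
    single : ∀ x x′ y y′ → 1 ≤ y →
             ∑[ j ∈ I ] (⟦ x * e i ≟ y * e j ⟧ * ⟦ x′ * e j ≟ y′ * e k ⟧) ≤ ⟦ x * x′ * e i ≟ y * y′ * e k ⟧
    single x x′ y y′ 1≤y = begin
      ∑[ j ∈ I ] (⟦ x * e i ≟ y * e j ⟧ * ⟦ x′ * e j ≟ y′ * e k ⟧)
        ≤⟨ ∑-mono I (λ j → ⟦⟧*-≤ (x * e i ≟ y * e j) λ p → ⟦⟧-≤ (x′ * e j ≟ y′ * e k) λ q →
             ≤-reflexive (sym (cong₂ _*_ (⟦⟧-yes (x * x′ * e i ≟ y * y′ * e k) (compose (e i) (e j) (e k) p q))
                                         (⟦⟧-yes (x * e i ≟ y * e j) p)))) ⟩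
      ∑[ j ∈ I ] (⟦ x * x′ * e i ≟ y * y′ * e k ⟧ * ⟦ x * e i ≟ y * e j ⟧)
        ≡⟨ ∑-*ˡ I ⟦ x * x′ * e i ≟ y * y′ * e k ⟧ _ ⟩
      ⟦ x * x′ * e i ≟ y * y′ * e k ⟧ * ∑[ j ∈ I ] ⟦ x * e i ≟ y * e j ⟧
        ≤⟨ *-monoʳ-≤ ⟦ x * x′ * e i ≟ y * y′ * e k ⟧ (∑-unique-≤1 (λ j → x * e i ≟ y * e j) (allFin⁺ n) λ _ _ p q →
             e-injective (*-cancelˡ-≡ _ _ y {{>-nonZero 1≤y}} (trans (sym p) q))) ⟩
      ⟦ x * x′ * e i ≟ y * y′ * e k ⟧ * 1
        ≡⟨ *-identityʳ _ ⟩
      ⟦ x * x′ * e i ≟ y * y′ * e k ⟧ ∎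
      where
      compose : ∀ a b c → x * a ≡ y * b → x′ * b ≡ y′ * c → x * x′ * a ≡ y * y′ * c
      compose a b c p q = begin-equality
        x * x′ * a     ≡⟨ rearrange x x′ a ⟩
        x′ * (x * a)   ≡⟨ cong (x′ *_) p ⟩
        x′ * (y * b)   ≡⟨ rearrange y x′ b ⟨
        y * x′ * b     ≡⟨ *-assoc y x′ b ⟩
        y * (x′ * b)   ≡⟨ cong (y *_) q ⟩
        y * (y′ * c)   ≡⟨ *-assoc y y′ c ⟨
        y * y′ * c     ∎
        where
        rearrange : ∀ u v w → u * v * w ≡ v * (u * w)
        rearrange = solve-∀

  -- Choosing `y` fixes `x * e i`, hence the value of `x`, which occurs at most `T` times in `L`.
  ratios-≤ : ∀ L T → (∀ v → ∑[ x ∈ L ] ⟦ x ≟ v ⟧ ≤ T) → ∀ i k → ratios L i k ≤ length L * T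
  ratios-≤ L T few i k = ≤-trans (≤-reflexive (∑-swap L L _)) (∑-≤-const L λ {y} _ → column (y * e k))
    where
    instance
      e≢0 : NonZero (e i)
      e≢0 = >-nonZero (1≤e i)
    column : ∀ c → ∑[ x ∈ L ] ⟦ x * e i ≟ c ⟧ ≤ T
    column c with e i ∣? c
    ... | yes (divides v refl) = ≤-trans (∑-mono L λ x → ⟦⟧-mono (x * e i ≟ v * e i) (x ≟ v) (*-cancelʳ-≡ x v (e i))) (few v)
    ... | no e∤c = ≤-trans (∑-≤-const L λ {x} _ → ⟦⟧-≤ (x * e i ≟ c) λ { refl → contradiction (n∣m*n x) e∤c })
                           (≤-trans (≤-reflexive (*-zeroʳ (length L))) z≤n)

  module _ (N : ℕ) where

    kernel : Fin n → Fin n → ℕ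
    kernel = ratios [1‥ N ]

    energy : ℕ
    energy = ∑[ i ∈ I ] ∑[ k ∈ I ] kernel i k

    kernel-power : ℕ → Fin n → Fin n → ℕ
    kernel-power zero    i k = kernel i k
    kernel-power (suc h) i k = ∑[ j ∈ I ] (kernel-power h i j * kernel-power h j k)

    total : ℕ → ℕ
    total h = ∑[ i ∈ I ] ∑[ k ∈ I ] kernel-power h i k

    kernel-power-sym : ∀ h i k → kernel-power h i k ≡ kernel-power h k i
    kernel-power-sym zero    i k = ratios-sym [1‥ N ] i k
    kernel-power-sym (suc h) i k = ∑-cong I λ j → trans (cong₂ _*_ (kernel-power-sym h i j) (kernel-power-sym h j k)) (*-comm (kernel-power h j i) _)

    kernel-power≤ratios : ∀ h i k → kernel-power h i k ≤ ratios (products N h) i k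
    kernel-power≤ratios zero    i k = ≤-refl
    kernel-power≤ratios (suc h) i k = ≤-trans (∑-mono I λ j → *-mono-≤ (kernel-power≤ratios h i j) (kernel-power≤ratios h j k))
      (ratios-step (products N h) (λ i → proj₁ (products-bounds N h i)) i k)

    -- With M the matrix `kernel-power h` and 1 the all-ones vector, Cauchy-Schwarz gives (1ᵀM1)² ≤
    -- n |M1|², and the symmetry of M turns |M1|² into 1ᵀM²1.
    total-step : ∀ h → total h * total h ≤ n * total (suc h)
    total-step h = begin
      total h * total h
        ≤⟨ cauchy-schwarz I _ ⟩
      length I * (∑[ j ∈ I ] (∑[ k ∈ I ] kernel-power h j k * ∑[ k ∈ I ] kernel-power h j k))
        ≡⟨ cong₂ _*_ length-I squares ⟩
      n * total (suc h) ∎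
      where
      squares : ∑[ j ∈ I ] (∑[ k ∈ I ] kernel-power h j k * ∑[ k ∈ I ] kernel-power h j k) ≡ total (suc h)
      squares = begin-equality
        ∑[ j ∈ I ] (∑[ k ∈ I ] kernel-power h j k * ∑[ k ∈ I ] kernel-power h j k)
          ≡⟨ ∑-cong I (λ j → ∑-*-∑ I I _ _) ⟩
        ∑[ j ∈ I ] ∑[ i ∈ I ] ∑[ k ∈ I ] (kernel-power h j i * kernel-power h j k)
          ≡⟨ ∑-cong I (λ j → ∑-cong I λ i → ∑-cong I λ k → cong (_* kernel-power h j k) (kernel-power-sym h j i)) ⟩
        ∑[ j ∈ I ] ∑[ i ∈ I ] ∑[ k ∈ I ] (kernel-power h i j * kernel-power h j k)
          ≡⟨ trans (∑-swap I I _) (∑-cong I λ i → ∑-swap I I _) ⟩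
        total (suc h) ∎

    -- This is (energy / n)^m ≤ total h / n for m = 2^h, a comparison of average row sums. Squaring
    -- it and applying `total-step` passes from m to 2m.
    energy-power : .{{NonZero n}} → ∀ h → energy ^ 2 ^ h * n ≤ n ^ 2 ^ h * total h
    energy-power zero    = ≤-reflexive (trans (*-comm (energy * 1) n) (cong₂ _*_ (sym (*-identityʳ n)) (*-identityʳ energy)))
    energy-power (suc h) = *-cancelʳ-≤ _ _ n (begin
      energy ^ 2 ^ suc h * n * n                            ≡⟨ cong (λ z → z * n * n) (^-2^suc energy h) ⟩
      energy ^ 2 ^ h * energy ^ 2 ^ h * n * n               ≡⟨ rearrange₁ (energy ^ 2 ^ h) n ⟩
      (energy ^ 2 ^ h * n) * (energy ^ 2 ^ h * n)           ≤⟨ *-mono-≤ (energy-power h) (energy-power h) ⟩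
      (n ^ 2 ^ h * total h) * (n ^ 2 ^ h * total h)         ≡⟨ rearrange₂ (n ^ 2 ^ h) (total h) ⟩
      n ^ 2 ^ h * n ^ 2 ^ h * (total h * total h)           ≡⟨ cong (_* (total h * total h)) (^-2^suc n h) ⟨
      n ^ 2 ^ suc h * (total h * total h)                   ≤⟨ *-monoʳ-≤ (n ^ 2 ^ suc h) (total-step h) ⟩
      n ^ 2 ^ suc h * (n * total (suc h))                   ≡⟨ rearrange₃ (n ^ 2 ^ suc h) n (total (suc h)) ⟩
      n ^ 2 ^ suc h * total (suc h) * n                     ∎)
      where
      rearrange₁ : ∀ a n → a * a * n * n ≡ (a * n) * (a * n)
      rearrange₁ = solve-∀
      rearrange₂ : ∀ a b → (a * b) * (a * b) ≡ a * a * (b * b)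
      rearrange₂ = solve-∀
      rearrange₃ : ∀ a b c → a * (b * c) ≡ a * c * b
      rearrange₃ = solve-∀

    energy-bound : .{{NonZero n}} → ∀ h → energy ^ 2 ^ h ≤ proj₁ (products-multiplicity h) * (n * N) ^ suc (2 ^ h)
    energy-bound h = *-cancelʳ-≤ _ _ n (begin
      energy ^ m * n                           ≤⟨ energy-power h ⟩
      n ^ m * total h                          ≤⟨ *-monoʳ-≤ (n ^ m) total≤ ⟩
      n ^ m * (n * (n * (N ^ m * (C * N))))    ≡⟨ rearrange (n ^ m) n (N ^ m) C N ⟩
      C * (n * N * (n ^ m * N ^ m)) * n        ≡⟨ cong (λ z → C * (n * N * z) * n) (^-distrib-* n N m) ⟨
      C * (n * N) ^ suc m * n                  ∎)
      where
      m = 2 ^ h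
      C = proj₁ (products-multiplicity h)
      total≤ : total h ≤ n * (n * (N ^ m * (C * N)))
      total≤ = ≤-trans (∑-≤-const I {c = n * (N ^ m * (C * N))} λ {i} _ →
                  ≤-trans (∑-≤-const I {c = N ^ m * (C * N)} λ {k} _ →
                     ≤-trans (kernel-power≤ratios h i k)
                       (≤-trans (ratios-≤ (products N h) (C * N) (proj₂ (proj₂ (products-multiplicity h)) N) i k)
                         (≤-reflexive (cong (_* (C * N)) (length-products N h)))))
                    (≤-reflexive (cong (_* (N ^ m * (C * N))) length-I)))
                 (≤-reflexive (cong (_* (n * (N ^ m * (C * N)))) length-I))
      rearrange : ∀ a n b c N → a * (n * (n * (b * (c * N)))) ≡ c * (n * N * (a * b)) * n
      rearrange = solve-∀

-- Coincidences between progressions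

∑-unique-≤ : ∀ {a p} {A : Set a} {P : A → Set p} (P? : ∀ x → Dec (P x)) {xs} {c} → Unique xs →
             (∀ {x y} → x ∈ xs → y ∈ xs → P x → P y → x ≡ y) → (∀ {x} → x ∈ xs → P x → 1 ≤ c) →
             ∑[ x ∈ xs ] ⟦ P? x ⟧ ≤ c
∑-unique-≤ P? {xs} {zero}  xs! unique 1≤c = ≤-trans (∑-≤-const xs λ {x} i → ⟦⟧-≤ (P? x) (1≤c i)) (≤-reflexive (*-zeroʳ (length xs)))
∑-unique-≤ P? {xs} {suc c} xs! unique 1≤c = ≤-trans (∑-unique-≤1 P? xs! unique) (s≤s z≤n)

∑-applyUpTo : ∀ {a} {A : Set a} (f : ℕ → A) L g → ∑ (applyUpTo f L) g ≡ ∑[ t ∈ upTo L ] g (f t)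
∑-applyUpTo f zero    g = refl
∑-applyUpTo f (suc L) g = cong (g (f 0) +_)
  (trans (∑-applyUpTo (λ t → f (suc t)) L g) (sym (∑-applyUpTo suc L (λ t → g (f t)))))

∑-upTo-suc : ∀ L g → ∑ (upTo (suc L)) g ≡ g 0 + ∑[ t ∈ upTo L ] g (suc t)
∑-upTo-suc L g = cong (g 0 +_) (∑-applyUpTo suc L g)

∑-upTo-+ : ∀ K L g → ∑ (upTo (K + L)) g ≡ ∑ (upTo K) g + ∑[ t ∈ upTo L ] g (K + t)
∑-upTo-+ zero    L g = refl
∑-upTo-+ (suc K) L g = begin
  ∑ (upTo (suc (K + L))) g                                  ≡⟨ ∑-upTo-suc (K + L) g ⟩
  g 0 + ∑[ t ∈ upTo (K + L) ] g (suc t)                     ≡⟨ cong (g 0 +_) (∑-upTo-+ K L _) ⟩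
  g 0 + (∑[ t ∈ upTo K ] g (suc t) + ∑[ t ∈ upTo L ] g (suc K + t)) ≡⟨ +-assoc (g 0) _ _ ⟨
  g 0 + ∑[ t ∈ upTo K ] g (suc t) + ∑[ t ∈ upTo L ] g (suc K + t)   ≡⟨ cong (_+ ∑[ t ∈ upTo L ] g (suc K + t)) (∑-upTo-suc K g) ⟨
  ∑ (upTo (suc K)) g + ∑[ t ∈ upTo L ] g (suc K + t)        ∎
  where open ≡-Reasoning

∑-upTo-mono : ∀ {K L} g → K ≤ L → ∑ (upTo K) g ≤ ∑ (upTo L) g
∑-upTo-mono {K} {L} g K≤L = subst (λ z → ∑ (upTo K) g ≤ ∑ (upTo z) g) (m+[n∸m]≡n K≤L)
  (≤-trans (m≤m+n _ _) (≤-reflexive (sym (∑-upTo-+ K (L ∸ K) g))))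

-- The progressions enter through `f-collide`, the subtraction-free form of (j′ - j) e i = (h′ - h)
-- e k: two coincidences between the same two progressions eliminate the first terms.
module Progressions
  {n : ℕ} (e : Fin n → ℕ) (1≤e : ∀ i → 1 ≤ e i) (e-injective : ∀ {i j} → e i ≡ e j → i ≡ j)
  (f : Fin n → ℕ → ℤ)
  (f-collide : ∀ i k j h j′ h′ → f i j ≡ f k h → f i j′ ≡ f k h′ → j′ * e i + h * e k ≡ j * e i + h′ * e k)
  {ℓ : ℕ} (S : List ℤ) (S! : Unique S) (f∈S : ∀ i {j} → j < ℓ → f i j ∈ S)
  where

  open Energy e 1≤e e-injective
  open ≤-Reasoning

  U : ℕ
  U = length S

  meet-unique : ∀ i k {j j′ h} → f i j ≡ f k h → f i j′ ≡ f k h → j ≡ j′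
  meet-unique i k {j} {j′} {h} p q = *-cancelʳ-≡ j j′ (e i) {{>-nonZero (1≤e i)}}
    (sym (+-cancelʳ-≡ (h * e k) (j′ * e i) (j * e i) (f-collide i k j h j′ h p q)))

  -- The triple (i, j, x) is sent to the pair of terms with indices `j` and `j + x`. If two triples
  -- have the same image, their first terms agree, which happens for at most `N` index pairs (j, h)
  -- since `j` determines `h`, and their steps satisfy `x * e i ≡ y * e k`, which the kernel counts.
  pair-bound : ∀ N → N + N ≤ ℓ → (n * (N * N)) * (n * (N * N)) ≤ (U * U) * (N * energy N)
  pair-bound N 2N≤ℓ = begin
    (n * (N * N)) * (n * (N * N))
      ≡⟨ cong₂ _*_ length-X length-X ⟨
    length X * length X
      ≤⟨ collisions (≡-dec ℤ._≟_ ℤ._≟_) X (cartesianProduct S S) φ (cartesianProduct⁺ S! S!) φ∈ ⟩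
    length (cartesianProduct S S) * (∑[ s ∈ X ] ∑[ t ∈ X ] ⟦ φ s ≟² φ t ⟧)
      ≤⟨ *-mono-≤ (≤-reflexive (length-product _,_ S S)) coincide ⟩
    (U * U) * (N * energy N) ∎
    where
    Y = cartesianProduct (upTo N) [1‥ N ]
    X = cartesianProduct I Y
    _≟²_ = ≡-dec ℤ._≟_ ℤ._≟_
    φ : Fin n × ℕ × ℕ → ℤ × ℤ
    φ (i , j , x) = f i j , f i (j + x)
    length-X : length X ≡ n * (N * N)
    length-X = trans (length-product _,_ I Y) (cong₂ _*_ length-I
      (trans (length-product _,_ (upTo N) [1‥ N ]) (cong₂ _*_ (length-upTo N) (length-applyUpTo suc N))))
    φ∈ : ∀ {s} → s ∈ X → φ s ∈ cartesianProduct S S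
    φ∈ {i , j , x} s∈ with ∈-cartesianProduct⁻ I Y s∈
    ... | _ , jx∈ with ∈-cartesianProduct⁻ (upTo N) [1‥ N ] jx∈
    ...   | j∈ , x∈ = ∈-cartesianProduct⁺
              (f∈S i (≤-trans (∈-upTo⁻ j∈) (≤-trans (m≤m+n N N) 2N≤ℓ)))
              -- From `suc j ≤ N` and `x ≤ N` the index `j + x` is below `N + N`, hence below `ℓ`.
              (f∈S i (≤-trans (+-mono-≤ (∈-upTo⁻ j∈) (proj₂ (∈[1‥]⁻ x∈))) 2N≤ℓ))
    split : ∀ i j x k h y → ⟦ φ (i , j , x) ≟² φ (k , h , y) ⟧ ≤ ⟦ f i j ℤ.≟ f k h ⟧ * ⟦ x * e i ≟ y * e k ⟧
    split i j x k h y = ⟦⟧-≤ (φ (i , j , x) ≟² φ (k , h , y)) λ p → ≤-reflexive (sym (cong₂ _*_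
      (⟦⟧-yes (f i j ℤ.≟ f k h) (cong proj₁ p))
      (⟦⟧-yes (x * e i ≟ y * e k) (cancel j h (e i) (e k) (f-collide i k j h (j + x) (h + y) (cong proj₁ p) (cong proj₂ p))))))
      where
      cancel : ∀ j h a b → (j + x) * a + h * b ≡ j * a + (h + y) * b → x * a ≡ y * b
      cancel j h a b p = +-cancelˡ-≡ (j * a + h * b) _ _ (trans (lhs j x a h b) (trans p (rhs j a h y b)))
        where
        lhs : ∀ j x a h b → j * a + h * b + x * a ≡ (j + x) * a + h * b
        lhs = solve-∀
        rhs : ∀ j a h y b → j * a + (h + y) * b ≡ j * a + h * b + y * b
        rhs = solve-∀
    coincide : ∑[ s ∈ X ] ∑[ t ∈ X ] ⟦ φ s ≟² φ t ⟧ ≤ N * energy N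
    coincide = begin
      ∑[ s ∈ X ] ∑[ t ∈ X ] ⟦ φ s ≟² φ t ⟧
        ≡⟨ unfold _ ⟩
      ∑[ i ∈ I ] ∑[ j ∈ upTo N ] ∑[ x ∈ [1‥ N ] ] ∑[ t ∈ X ] ⟦ φ (i , j , x) ≟² φ t ⟧
        ≡⟨ ∑-cong I (λ i → ∑-cong (upTo N) λ j → ∑-cong [1‥ N ] λ x → unfold _) ⟩
      ∑[ i ∈ I ] ∑[ j ∈ upTo N ] ∑[ x ∈ [1‥ N ] ] ∑[ k ∈ I ] ∑[ h ∈ upTo N ] ∑[ y ∈ [1‥ N ] ] ⟦ φ (i , j , x) ≟² φ (k , h , y) ⟧
        ≤⟨ ∑-mono I (λ i → ∑-mono (upTo N) λ j → ∑-mono [1‥ N ] λ x →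
             ∑-mono I λ k → ∑-mono (upTo N) λ h → ∑-mono [1‥ N ] λ y → split i j x k h y) ⟩
      ∑[ i ∈ I ] ∑[ j ∈ upTo N ] ∑[ x ∈ [1‥ N ] ] ∑[ k ∈ I ] ∑[ h ∈ upTo N ] ∑[ y ∈ [1‥ N ] ] (⟦ f i j ℤ.≟ f k h ⟧ * ⟦ x * e i ≟ y * e k ⟧)
        ≡⟨ ∑-cong I (λ i → trans (∑-cong (upTo N) λ j → ∑-swap [1‥ N ] I _) (∑-swap (upTo N) I _)) ⟩
      ∑[ i ∈ I ] ∑[ k ∈ I ] ∑[ j ∈ upTo N ] ∑[ x ∈ [1‥ N ] ] ∑[ h ∈ upTo N ] ∑[ y ∈ [1‥ N ] ] (⟦ f i j ℤ.≟ f k h ⟧ * ⟦ x * e i ≟ y * e k ⟧)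
        ≡⟨ ∑-cong I (λ i → ∑-cong I λ k → trans
             (∑-cong (upTo N) λ j → ∑-cong [1‥ N ] λ x → sym (∑-*-∑ (upTo N) [1‥ N ] _ _))
             (sym (∑-*-∑ (upTo N) [1‥ N ] _ _))) ⟩
      ∑[ i ∈ I ] ∑[ k ∈ I ] (∑[ j ∈ upTo N ] ∑[ h ∈ upTo N ] ⟦ f i j ℤ.≟ f k h ⟧ * kernel N i k)
        ≤⟨ ∑-mono I (λ i → ∑-mono I λ k → *-monoˡ-≤ (kernel N i k) (meetings i k)) ⟩
      ∑[ i ∈ I ] ∑[ k ∈ I ] (N * kernel N i k)
        ≡⟨ trans (∑-cong I λ i → ∑-*ˡ I N _) (∑-*ˡ I N _) ⟩
      N * energy N ∎
      where
      unfold : ∀ (g : Fin n × ℕ × ℕ → ℕ) → ∑ X g ≡ ∑[ i ∈ I ] ∑[ j ∈ upTo N ] ∑[ x ∈ [1‥ N ] ] g (i , j , x)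
      unfold g = trans (∑-product _,_ I Y g) (∑-cong I λ i → ∑-product _,_ (upTo N) [1‥ N ] _)
      meetings : ∀ i k → ∑[ j ∈ upTo N ] ∑[ h ∈ upTo N ] ⟦ f i j ℤ.≟ f k h ⟧ ≤ N
      meetings i k = begin
        ∑[ j ∈ upTo N ] ∑[ h ∈ upTo N ] ⟦ f i j ℤ.≟ f k h ⟧
          ≤⟨ ∑-≤-const (upTo N) (λ {j} _ → ∑-unique-≤1 (λ h → f i j ℤ.≟ f k h) (upTo⁺ N)
               λ _ _ p q → meet-unique k i (sym p) (sym q)) ⟩
        length (upTo N) * 1   ≡⟨ trans (*-identityʳ _) (length-upTo N) ⟩
        N                     ∎

  -- Either 0 or 1: whether term `h` of progression `k` lies on progression `i`. As a number it can
  -- be summed over `h` to count common points.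
  hits : Fin n → Fin n → ℕ → ℕ
  hits i k h = ∑[ j ∈ upTo ℓ ] ⟦ f i j ℤ.≟ f k h ⟧

  hits-≤ : ∀ i k h {c} → (∀ {j} → f i j ≡ f k h → 1 ≤ c) → hits i k h ≤ c
  hits-≤ i k h 1≤c = ∑-unique-≤ (λ j → f i j ℤ.≟ f k h) (upTo⁺ ℓ) (λ _ _ p q → meet-unique i k p q) λ _ → 1≤c

  -- All common points in a block of N consecutive terms are counted from the first one; since
  -- e k ≤ e i, the index distances in the sparser progression i are then at most N as well.
  block-hits : ∀ N i k → e k ≤ e i → ∀ L → L ≤ N → ∀ h → ∑[ t ∈ upTo L ] hits i k (h + t) ≤ 1 + kernel N i k
  block-hits N i k ek≤ei zero    _    h = z≤n
  block-hits N i k ek≤ei (suc L) L<N h with any? (λ j → f i j ℤ.≟ f k h) (upTo ℓ)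
  -- Progression `i` misses the first term of the block, so the block is shortened from the left
  -- until it starts at a common point.
  ... | no none = begin
    ∑[ t ∈ upTo (suc L) ] hits i k (h + t)                    ≡⟨ ∑-upTo-suc L _ ⟩
    hits i k (h + 0) + ∑[ t ∈ upTo L ] hits i k (h + suc t)   ≤⟨ +-monoˡ-≤ _ no-hits ⟩
    ∑[ t ∈ upTo L ] hits i k (h + suc t)                      ≡⟨ ∑-cong (upTo L) (λ t → cong (hits i k) (+-suc h t)) ⟩
    ∑[ t ∈ upTo L ] hits i k (suc h + t)                      ≤⟨ block-hits N i k ek≤ei L (<⇒≤ L<N) (suc h) ⟩
    1 + kernel N i k                                          ∎
    where
    no-hits : hits i k (h + 0) ≤ 0
    no-hits = ≤-trans
      (∑-≤-const (upTo ℓ) λ {j} j∈ → ⟦⟧-≤ (f i j ℤ.≟ f k (h + 0)) λ p →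
        contradiction (lose j∈ (trans p (cong (f k) (+-identityʳ h)))) none)
      (≤-reflexive (*-zeroʳ (length (upTo ℓ))))
  ... | yes some with find some
  ...   | j₀ , _ , first = begin
    ∑[ t ∈ upTo (suc L) ] hits i k (h + t)                       ≡⟨ ∑-upTo-suc L _ ⟩
    hits i k (h + 0) + ∑[ t ∈ upTo L ] hits i k (h + suc t)      ≤⟨ +-mono-≤ (hits-≤ i k (h + 0) λ _ → ≤-refl) (∑-mono-∈ (upTo L) λ {t} t∈ → later (suc t) (s≤s z≤n) (≤-trans (∈-upTo⁻ t∈) (<⇒≤ L<N))) ⟩
    1 + ∑[ t ∈ upTo L ] row (suc t)                              ≤⟨ +-monoʳ-≤ 1 (∑-mono-upTo) ⟩
    1 + ∑[ y ∈ [1‥ N ] ] row y                                   ≡⟨ cong (1 +_) (∑-swap [1‥ N ] [1‥ N ] _) ⟩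
    1 + kernel N i k                                             ∎
    where
    row : ℕ → ℕ
    row y = ∑[ x ∈ [1‥ N ] ] ⟦ x * e i ≟ y * e k ⟧
    later : ∀ y → 1 ≤ y → y ≤ N → hits i k (h + y) ≤ row y
    later y 1≤y y≤N = hits-≤ i k (h + y) λ {j} p → counted j (shift j p)
      where
      shift : ∀ j → f i j ≡ f k (h + y) → j * e i ≡ j₀ * e i + y * e k
      shift j p = +-cancelʳ-≡ (h * e k) _ _ (trans (f-collide i k j₀ h j (h + y) first p) (regroup (j₀ * e i) h y (e k)))
        where
        regroup : ∀ a h y b → a + (h + y) * b ≡ a + y * b + h * b
        regroup = solve-∀
      counted : ∀ j → j * e i ≡ j₀ * e i + y * e k → 1 ≤ row y
      counted j p = ≤-trans (≤-reflexive (sym (⟦⟧-yes (x * e i ≟ y * e k) x-ratio)))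
                            (f≤∑ (λ z → ⟦ z * e i ≟ y * e k ⟧) (∈[1‥]⁺ 1≤x x≤N))
        where
        instance
          ei≢0 : NonZero (e i)
          ei≢0 = >-nonZero (1≤e i)
        -- The common point `y` terms further along `k` also comes later on `i`, so the index
        -- distance `j ∸ j₀` is a genuine difference.
        j₀<j : j₀ < j
        j₀<j = *-cancelʳ-< (e i) j₀ j (≤-trans (m<m+n (j₀ * e i) (*-mono-≤ 1≤y (1≤e k))) (≤-reflexive (sym p)))
        x = j ∸ j₀
        1≤x : 1 ≤ x
        1≤x = m<n⇒0<n∸m j₀<j
        x-ratio : x * e i ≡ y * e k
        x-ratio = trans (*-distribʳ-∸ (e i) j j₀) (trans (cong (_∸ j₀ * e i) p) (m+n∸m≡n (j₀ * e i) (y * e k)))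
        x≤N : x ≤ N
        x≤N = ≤-trans (*-cancelʳ-≤ x y (e i) (≤-trans (≤-reflexive x-ratio) (*-monoʳ-≤ y ek≤ei))) y≤N
    ∑-mono-upTo : ∑[ t ∈ upTo L ] row (suc t) ≤ ∑[ y ∈ [1‥ N ] ] row y
    ∑-mono-upTo = ≤-trans (∑-upTo-mono _ (<⇒≤ L<N)) (≤-reflexive (sym (∑-applyUpTo suc N row)))

  blocks-hits : ∀ N i k → e k ≤ e i → ∀ B h → ∑[ t ∈ upTo (B * N) ] hits i k (h + t) ≤ B * (1 + kernel N i k)
  blocks-hits N i k ek≤ei zero    h = z≤n
  blocks-hits N i k ek≤ei (suc B) h = begin
    ∑[ t ∈ upTo (N + B * N) ] hits i k (h + t)
      ≡⟨ ∑-upTo-+ N (B * N) _ ⟩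
    ∑[ t ∈ upTo N ] hits i k (h + t) + ∑[ t ∈ upTo (B * N) ] hits i k (h + (N + t))
      ≡⟨ cong (∑[ t ∈ upTo N ] hits i k (h + t) +_) (∑-cong (upTo (B * N)) λ t → cong (hits i k) (sym (+-assoc h N t))) ⟩
    ∑[ t ∈ upTo N ] hits i k (h + t) + ∑[ t ∈ upTo (B * N) ] hits i k (h + N + t)
      ≤⟨ +-mono-≤ (block-hits N i k ek≤ei N ≤-refl h) (blocks-hits N i k ek≤ei B (h + N)) ⟩
    suc B * (1 + kernel N i k) ∎

  common : Fin n → Fin n → ℕ
  common i k = ∑[ j ∈ upTo ℓ ] ∑[ h ∈ upTo ℓ ] ⟦ f i j ℤ.≟ f k h ⟧

  common-sym : ∀ i k → common i k ≡ common k i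
  common-sym i k = trans (∑-swap (upTo ℓ) (upTo ℓ) _) (∑-cong (upTo ℓ) λ h → ∑-cong (upTo ℓ) λ j →
    ≤-antisym (⟦⟧-mono (f i j ℤ.≟ f k h) (f k h ℤ.≟ f i j) sym) (⟦⟧-mono (f k h ℤ.≟ f i j) (f i j ℤ.≟ f k h) sym))

  common-≤-sparser : ∀ N B → ℓ ≤ B * N → ∀ i k → e k ≤ e i → common i k ≤ B * (1 + kernel N i k)
  common-≤-sparser N B ℓ≤BN i k ek≤ei = begin
    common i k                         ≡⟨ ∑-swap (upTo ℓ) (upTo ℓ) _ ⟩
    ∑[ h ∈ upTo ℓ ] hits i k h         ≤⟨ ∑-upTo-mono (hits i k) ℓ≤BN ⟩
    ∑[ h ∈ upTo (B * N) ] hits i k h   ≤⟨ blocks-hits N i k ek≤ei B 0 ⟩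
    B * (1 + kernel N i k)             ∎

  -- Both sides are symmetric in `i` and `k`, so the sparser progression may be put first.
  common-≤ : ∀ N B → ℓ ≤ B * N → ∀ i k → common i k ≤ B * (1 + kernel N i k)
  common-≤ N B ℓ≤BN i k with ≤-total (e k) (e i)
  ... | inj₁ ek≤ei = common-≤-sparser N B ℓ≤BN i k ek≤ei
  ... | inj₂ ei≤ek = subst₂ (λ c z → c ≤ B * (1 + z)) (common-sym k i) (ratios-sym [1‥ N ] k i)
                            (common-≤-sparser N B ℓ≤BN k i ei≤ek)

  -- The term `n * n` accounts for the first common point in each block, which the kernel does not
  -- see.
  point-bound : ∀ N B → ℓ ≤ B * N → (n * ℓ) * (n * ℓ) ≤ U * (B * (n * n + energy N))
  point-bound N B ℓ≤BN = begin
    (n * ℓ) * (n * ℓ)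
      ≡⟨ cong₂ _*_ length-X length-X ⟨
    length X * length X
      ≤⟨ collisions ℤ._≟_ X S φ S! f∈ ⟩
    U * (∑[ s ∈ X ] ∑[ t ∈ X ] ⟦ φ s ℤ.≟ φ t ⟧)
      ≤⟨ *-monoʳ-≤ U coincide ⟩
    U * (B * (n * n + energy N)) ∎
    where
    X = cartesianProduct I (upTo ℓ)
    φ : Fin n × ℕ → ℤ
    φ (i , j) = f i j
    length-X : length X ≡ n * ℓ
    length-X = trans (length-product _,_ I (upTo ℓ)) (cong₂ _*_ length-I (length-upTo ℓ))
    f∈ : ∀ {s} → s ∈ X → φ s ∈ S
    f∈ {i , j} s∈ = f∈S i (∈-upTo⁻ (proj₂ (∈-cartesianProduct⁻ I (upTo ℓ) s∈)))
    coincide : ∑[ s ∈ X ] ∑[ t ∈ X ] ⟦ φ s ℤ.≟ φ t ⟧ ≤ B * (n * n + energy N)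
    coincide = begin
      ∑[ s ∈ X ] ∑[ t ∈ X ] ⟦ φ s ℤ.≟ φ t ⟧
        ≡⟨ trans (∑-product _,_ I (upTo ℓ) _) (∑-cong I λ i → ∑-cong (upTo ℓ) λ j → ∑-product _,_ I (upTo ℓ) _) ⟩
      ∑[ i ∈ I ] ∑[ j ∈ upTo ℓ ] ∑[ k ∈ I ] ∑[ h ∈ upTo ℓ ] ⟦ f i j ℤ.≟ f k h ⟧
        ≡⟨ ∑-cong I (λ i → ∑-swap (upTo ℓ) I _) ⟩
      ∑[ i ∈ I ] ∑[ k ∈ I ] common i k
        ≤⟨ ∑-mono I (λ i → ∑-mono I λ k → common-≤ N B ℓ≤BN i k) ⟩
      ∑[ i ∈ I ] ∑[ k ∈ I ] (B * (1 + kernel N i k))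
        ≡⟨ trans (∑-cong I λ i → ∑-*ˡ I B _) (∑-*ˡ I B _) ⟩
      B * (∑[ i ∈ I ] ∑[ k ∈ I ] (1 + kernel N i k))
        ≡⟨ cong (B *_) (trans (∑-cong I λ i → ∑-+ I _ _) (∑-+ I _ _)) ⟩
      B * (∑[ i ∈ I ] ∑[ k ∈ I ] 1 + energy N)
        ≡⟨ cong (λ z → B * (z + energy N)) (trans (∑-const I _) (cong₂ _*_ length-I (trans (∑-const I 1) (trans (*-identityʳ _) length-I)))) ⟩
      B * (n * n + energy N) ∎

-- Differences of one sign

lookup-unique : ∀ {a} {A : Set a} {xs : List A} → Unique xs → ∀ {i j} → lookup xs i ≡ lookup xs j → i ≡ j
lookup-unique (x∉ ∷ xs!) {zero}  {zero}  p = refl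
lookup-unique (x∉ ∷ xs!) {zero}  {suc j} p = contradiction p (All.lookup x∉ (∈-lookup j))
lookup-unique (x∉ ∷ xs!) {suc i} {zero}  p = contradiction (sym p) (All.lookup x∉ (∈-lookup i))
lookup-unique (x∉ ∷ xs!) {suc i} {suc j} p = cong suc (lookup-unique xs! p)

length-filter-∑ : ∀ {a p} {A : Set a} {P : A → Set p} (P? : ∀ x → Dec (P x)) xs →
                  length (filter P? xs) ≡ ∑[ x ∈ xs ] ⟦ P? x ⟧
length-filter-∑ P? []       = refl
length-filter-∑ P? (x ∷ xs) with P? x
... | yes _ = cong suc (length-filter-∑ P? xs)
... | no  _ = length-filter-∑ P? xs

module Union {n : ℕ} (F : Family n) (distinct : DistinctDiffs F) (ℓ : ℕ) where

  open import Data.Integer.Base using (+_)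

  d : Fin n → ℤ
  d i = proj₂ (F i)

  -- Applied to `1ℤ` and `-1ℤ`. Within one sign class the absolute values are still distinct, and
  -- the common factor `σ` cancels from every relation between differences.
  module Aligned (σ : ℤ) {{σ≢0 : ℤ.NonZero σ}} where

    IsAligned : Fin n → Set
    IsAligned i = 1 ≤ ∣ d i ∣ × d i ≡ σ ℤ.* + ∣ d i ∣

    aligned? : ∀ i → Dec (IsAligned i)
    aligned? i = (1 ≤? ∣ d i ∣) ×-dec (d i ℤ.≟ σ ℤ.* + ∣ d i ∣)

    K : List (Fin n)
    K = filter aligned? (allFin n)

    ι : Fin (length K) → Fin n
    ι = lookup K

    ι-injective : ∀ {i j} → ι i ≡ ι j → i ≡ j
    ι-injective = lookup-unique (filter⁺ aligned? (allFin⁺ n))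

    ι-aligned : ∀ i → IsAligned (ι i)
    ι-aligned i = proj₂ (∈-filter⁻ aligned? {xs = allFin n} (∈-lookup i))

    length-K≤n : length K ≤ n
    length-K≤n = injective⇒≤ ι-injective

    e : Fin (length K) → ℕ
    e i = ∣ d (ι i) ∣

    1≤e : ∀ i → 1 ≤ e i
    1≤e i = proj₁ (ι-aligned i)

    d≡ : ∀ i → d (ι i) ≡ σ ℤ.* + e i
    d≡ i = proj₂ (ι-aligned i)

    e-injective : ∀ {i j} → e i ≡ e j → i ≡ j
    e-injective {i} {j} p = ι-injective (distinct (ι i) (ι j)
      (trans (d≡ i) (trans (cong (λ z → σ ℤ.* + z) p) (sym (d≡ j)))))

    term : Fin (length K) → ℕ → ℤ
    term i j = proj₁ (F (ι i)) ℤ.+ + j ℤ.* d (ι i)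

    term-collide : ∀ i k j h j′ h′ → term i j ≡ term k h → term i j′ ≡ term k h′ →
                   j′ * e i + h * e k ≡ j * e i + h′ * e k
    term-collide i k j h j′ h′ p q = ℤ.+-injective (ℤ.*-cancelˡ-≡ σ _ _ (begin
      σ ℤ.* + (j′ * e i + h * e k)               ≡⟨ scaled j′ h ⟩
      + j′ ℤ.* d (ι i) ℤ.+ + h ℤ.* d (ι k)       ≡⟨ ℤ-+-cancelˡ (a ℤ.+ b) _ _ sums ⟩
      + j ℤ.* d (ι i) ℤ.+ + h′ ℤ.* d (ι k)       ≡⟨ scaled j h′ ⟨
      σ ℤ.* + (j * e i + h′ * e k)               ∎))
      where
      open ≡-Reasoning
      a = proj₁ (F (ι i))
      b = proj₁ (F (ι k))
      scaled : ∀ u v → σ ℤ.* + (u * e i + v * e k) ≡ + u ℤ.* d (ι i) ℤ.+ + v ℤ.* d (ι k)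
      scaled u v = begin
        σ ℤ.* + (u * e i + v * e k)
          ≡⟨ cong (σ ℤ.*_) (trans (ℤ.pos-+ (u * e i) (v * e k)) (cong₂ ℤ._+_ (ℤ.pos-* u (e i)) (ℤ.pos-* v (e k)))) ⟩
        σ ℤ.* (+ u ℤ.* + e i ℤ.+ + v ℤ.* + e k)
          ≡⟨ rearrange σ (+ u) (+ e i) (+ v) (+ e k) ⟩
        + u ℤ.* (σ ℤ.* + e i) ℤ.+ + v ℤ.* (σ ℤ.* + e k)
          ≡⟨ cong₂ (λ y z → + u ℤ.* y ℤ.+ + v ℤ.* z) (d≡ i) (d≡ k) ⟨
        + u ℤ.* d (ι i) ℤ.+ + v ℤ.* d (ι k) ∎
        where
        rearrange : ∀ s u x v y → s ℤ.* (u ℤ.* x ℤ.+ v ℤ.* y) ≡ u ℤ.* (s ℤ.* x) ℤ.+ v ℤ.* (s ℤ.* y)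
        rearrange = ℤ-Solver.solve-∀
      -- Adding `q` to the reversed `p` puts both first terms on both sides, ready for cancellation.
      sums : a ℤ.+ b ℤ.+ (+ j′ ℤ.* d (ι i) ℤ.+ + h ℤ.* d (ι k)) ≡ a ℤ.+ b ℤ.+ (+ j ℤ.* d (ι i) ℤ.+ + h′ ℤ.* d (ι k))
      sums = trans (regroup₁ a b (+ j′ ℤ.* d (ι i)) (+ h ℤ.* d (ι k)))
        (trans (cong₂ ℤ._+_ q (sym p)) (regroup₂ a b (+ j ℤ.* d (ι i)) (+ h′ ℤ.* d (ι k))))
        where
        regroup₁ : ∀ a b x y → a ℤ.+ b ℤ.+ (x ℤ.+ y) ≡ a ℤ.+ x ℤ.+ (b ℤ.+ y)
        regroup₁ = ℤ-Solver.solve-∀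
        regroup₂ : ∀ a b x y → b ℤ.+ y ℤ.+ (a ℤ.+ x) ≡ a ℤ.+ b ℤ.+ (x ℤ.+ y)
        regroup₂ = ℤ-Solver.solve-∀

    term∈ : ∀ i {j} → j < ℓ → term i j ∈ deduplicate ℤ._≟_ (unionList F ℓ)
    term∈ i {j} j<ℓ = ∈-deduplicate⁺ ℤ._≟_ (∈-concatMap⁺ (λ k → AP (proj₁ (F k)) (d k) ℓ)
      (lose (∈-allFin (ι i)) (∈-map⁺ (λ t → proj₁ (F (ι i)) ℤ.+ + t ℤ.* d (ι i)) (∈-upTo⁺ j<ℓ))))

    open Energy e 1≤e e-injective public using (energy; energy-bound)
    open Progressions e 1≤e e-injective term term-collide
      (deduplicate ℤ._≟_ (unionList F ℓ)) (deduplicate-! (unionList F ℓ)) term∈ public using (pair-bound; point-bound)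

  -- The 1 is for a zero difference, of which distinctness allows at most one.
  aligned-cover : n ≤ 1 + (length (Aligned.K 1ℤ) + length (Aligned.K -1ℤ))
  aligned-cover = begin
    n                        ≡⟨ length-tabulate (λ i → i) ⟨
    length (allFin n)        ≡⟨ *-identityʳ _ ⟨
    length (allFin n) * 1    ≡⟨ ∑-const (allFin n) 1 ⟨
    ∑[ i ∈ allFin n ] 1      ≤⟨ ∑-mono (allFin n) trichotomy ⟩
    ∑[ i ∈ allFin n ] (⟦ d i ℤ.≟ 0ℤ ⟧ + (⟦ Aligned.aligned? 1ℤ i ⟧ + ⟦ Aligned.aligned? -1ℤ i ⟧))
      ≡⟨ trans (∑-+ (allFin n) _ _) (cong₂ _+_ refl (∑-+ (allFin n) _ _)) ⟩
    ∑[ i ∈ allFin n ] ⟦ d i ℤ.≟ 0ℤ ⟧ + (∑[ i ∈ allFin n ] ⟦ Aligned.aligned? 1ℤ i ⟧ + ∑[ i ∈ allFin n ] ⟦ Aligned.aligned? -1ℤ i ⟧)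
      ≤⟨ +-mono-≤ (∑-unique-≤1 (λ i → d i ℤ.≟ 0ℤ) (allFin⁺ n) λ {i} {j} _ _ p q → distinct i j (trans p (sym q)))
           (≤-reflexive (sym (cong₂ _+_ (length-filter-∑ (Aligned.aligned? 1ℤ) (allFin n)) (length-filter-∑ (Aligned.aligned? -1ℤ) (allFin n))))) ⟩
    1 + (length (Aligned.K 1ℤ) + length (Aligned.K -1ℤ)) ∎
    where
    open ≤-Reasoning
    sign : ∀ z → (z ≡ 0ℤ) ⊎ (1 ≤ ∣ z ∣ × z ≡ 1ℤ ℤ.* + ∣ z ∣) ⊎ (1 ≤ ∣ z ∣ × z ≡ -1ℤ ℤ.* + ∣ z ∣)
    sign (+ zero)   = inj₁ refl
    sign (+ suc z)  = inj₂ (inj₁ (s≤s z≤n , sym (ℤ.*-identityˡ (+ suc z))))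
    sign -[1+ z ]   = inj₂ (inj₂ (s≤s z≤n , sym (ℤ.-1*i≡-i (+ suc z))))
    trichotomy : ∀ i → 1 ≤ ⟦ d i ℤ.≟ 0ℤ ⟧ + (⟦ Aligned.aligned? 1ℤ i ⟧ + ⟦ Aligned.aligned? -1ℤ i ⟧)
    trichotomy i with sign (d i)
    ... | inj₁ z        = m≤n⇒m≤n+o _ (≤-reflexive (sym (⟦⟧-yes (d i ℤ.≟ 0ℤ) z)))
    ... | inj₂ (inj₁ p) = m≤n⇒m≤o+n ⟦ d i ℤ.≟ 0ℤ ⟧ (m≤n⇒m≤n+o _ (≤-reflexive (sym (⟦⟧-yes (Aligned.aligned? 1ℤ i) p))))
    ... | inj₂ (inj₂ p) = m≤n⇒m≤o+n ⟦ d i ℤ.≟ 0ℤ ⟧ (m≤n⇒m≤o+n ⟦ Aligned.aligned? 1ℤ i ⟧ (≤-reflexive (sym (⟦⟧-yes (Aligned.aligned? -1ℤ i) p))))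

  U : ℕ
  U = unionCard F ℓ

  -- The bounds for the larger sign class, restated for the whole family. That class has r ≥ 1
  -- members with n ≤ 1 + 2r ≤ 3r, whence the factor 9 = 3².
  record UnionBounds (h : ℕ) : Set where
    field
      E       : ℕ → ℕ
      E-bound : ∀ N → E N ^ 2 ^ h ≤ proj₁ (products-multiplicity h) * (n * N) ^ suc (2 ^ h)
      pairs   : ∀ N → 1 ≤ N → N + N ≤ ℓ → n * n * (N * N * N) ≤ 9 * (U * U) * E N
      points  : ∀ N B → ℓ ≤ B * N → (n * ℓ) * (n * ℓ) ≤ 9 * (U * (B * (n * n + E N)))

  union-bounds-aligned : 1 < n → ∀ h (σ : ℤ) {{_ : ℤ.NonZero σ}} → n ≤ 1 + 2 * length (Aligned.K σ) → UnionBounds h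
  union-bounds-aligned 1<n h σ n≤1+2r = record
    { E       = energy
    ; E-bound = λ N → ≤-trans (energy-bound N h) (*-monoʳ-≤ C (^-monoˡ-≤ (suc m) (*-monoˡ-≤ N length-K≤n)))
    ; pairs   = λ N 1≤N 2N≤ℓ → *-cancelʳ-≤ _ _ N {{>-nonZero 1≤N}} (begin
        n * n * (N * N * N) * N                    ≡⟨ rearrange₁ n N ⟩
        n * n * (N * N * (N * N))                  ≤⟨ *-monoˡ-≤ (N * N * (N * N)) n²≤9r² ⟩
        9 * (r * r) * (N * N * (N * N))            ≡⟨ rearrange₂ r N ⟩
        9 * ((r * (N * N)) * (r * (N * N)))        ≤⟨ *-monoʳ-≤ 9 (pair-bound N 2N≤ℓ) ⟩
        9 * (U * U * (N * energy N))               ≡⟨ rearrange₃ U N (energy N) ⟩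
        9 * (U * U) * energy N * N                 ∎)
    ; points  = λ N B ℓ≤BN → begin
        n * ℓ * (n * ℓ)                            ≡⟨ rearrange₄ n ℓ ⟩
        n * n * (ℓ * ℓ)                            ≤⟨ *-monoˡ-≤ (ℓ * ℓ) n²≤9r² ⟩
        9 * (r * r) * (ℓ * ℓ)                      ≡⟨ rearrange₅ r ℓ ⟩
        9 * ((r * ℓ) * (r * ℓ))                    ≤⟨ *-monoʳ-≤ 9 (point-bound N B ℓ≤BN) ⟩
        9 * (U * (B * (r * r + energy N)))         ≤⟨ *-monoʳ-≤ 9 (*-monoʳ-≤ U (*-monoʳ-≤ B (+-monoˡ-≤ (energy N) (*-mono-≤ length-K≤n length-K≤n)))) ⟩
        9 * (U * (B * (n * n + energy N)))         ∎
    }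
    where
    open ≤-Reasoning
    open Aligned σ
    m = 2 ^ h
    C = proj₁ (products-multiplicity h)
    r = length K
    1≤r : 1 ≤ r
    1≤r = *-cancelˡ-< 2 0 r (s≤s⁻¹ (≤-trans 1<n n≤1+2r))
    instance
      r≢0 : NonZero r
      r≢0 = >-nonZero 1≤r
    n≤3r : n ≤ 3 * r
    n≤3r = ≤-trans n≤1+2r (+-monoˡ-≤ (2 * r) 1≤r)
    n²≤9r² : n * n ≤ 9 * (r * r)
    n²≤9r² = ≤-trans (*-mono-≤ n≤3r n≤3r) (≤-reflexive (square r))
      where
      square : ∀ r → 3 * r * (3 * r) ≡ 9 * (r * r)
      square = solve-∀
    rearrange₁ : ∀ n N → n * n * (N * N * N) * N ≡ n * n * (N * N * (N * N))
    rearrange₁ = solve-∀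
    rearrange₂ : ∀ r N → 9 * (r * r) * (N * N * (N * N)) ≡ 9 * ((r * (N * N)) * (r * (N * N)))
    rearrange₂ = solve-∀
    rearrange₃ : ∀ U N E → 9 * (U * U * (N * E)) ≡ 9 * (U * U) * E * N
    rearrange₃ = solve-∀
    rearrange₄ : ∀ n ℓ → n * ℓ * (n * ℓ) ≡ n * n * (ℓ * ℓ)
    rearrange₄ = solve-∀
    rearrange₅ : ∀ r ℓ → 9 * (r * r) * (ℓ * ℓ) ≡ 9 * ((r * ℓ) * (r * ℓ))
    rearrange₅ = solve-∀

  union-bounds : 1 < n → ∀ h → UnionBounds h
  union-bounds 1<n h with ≤-total (length (Aligned.K 1ℤ)) (length (Aligned.K -1ℤ))
  ... | inj₁ p≤q = union-bounds-aligned 1<n h -1ℤ (≤-trans aligned-cover (s≤s (+-mono-≤ p≤q (m≤m+n _ 0))))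
  ... | inj₂ q≤p = union-bounds-aligned 1<n h 1ℤ (≤-trans aligned-cover (s≤s (+-monoʳ-≤ _ (≤-trans q≤p (m≤m+n _ 0)))))

-- The three ranges of ℓ

^-2* : ∀ x k → x ^ (2 * k) ≡ (x ^ k) ^ 2
^-2* x k = trans (cong (x ^_) (*-comm 2 k)) (sym (^-*-assoc x k 2))

m*m≡m^2 : ∀ x → x * x ≡ x ^ 2
m*m≡m^2 x = cong (x *_) (sym (*-identityʳ x))

-- Read E / Z ≤ (C Z)^(1/m) as the loss in dividing by Z = nN; as Z ≤ n², it is at most C n^(2/m).
energy-root : ∀ C .{{_ : NonZero C}} m .{{_ : NonZero m}} n E X Y Z → 1 ≤ Z → Z ≤ n * n →
                E ^ m ≤ C * Z ^ suc m → X * Z ≤ Y * E → X ^ m ≤ (C * Y) ^ m * n ^ 2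
energy-root C m n E X Y Z 1≤Z Z≤n² E^m≤ XZ≤YE = *-cancelʳ-≤ _ _ (Z ^ m) {{m^n≢0 Z m {{>-nonZero 1≤Z}}}} (begin
  X ^ m * Z ^ m                    ≡⟨ ^-distrib-* X Z m ⟨
  (X * Z) ^ m                      ≤⟨ ^-monoˡ-≤ m XZ≤YE ⟩
  (Y * E) ^ m                      ≡⟨ ^-distrib-* Y E m ⟩
  Y ^ m * E ^ m                    ≤⟨ *-monoʳ-≤ (Y ^ m) E^m≤ ⟩
  Y ^ m * (C * (Z * Z ^ m))        ≤⟨ *-monoʳ-≤ (Y ^ m) (*-mono-≤ C≤C^m (*-monoˡ-≤ (Z ^ m) (≤-trans Z≤n² (≤-reflexive (m*m≡m^2 n))))) ⟩
  Y ^ m * (C ^ m * (n ^ 2 * Z ^ m)) ≡⟨ rearrange (Y ^ m) (C ^ m) (n ^ 2) (Z ^ m) ⟩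
  C ^ m * Y ^ m * n ^ 2 * Z ^ m    ≡⟨ cong (λ z → z * n ^ 2 * Z ^ m) (^-distrib-* C Y m) ⟨
  (C * Y) ^ m * n ^ 2 * Z ^ m      ∎)
  where
  open ≤-Reasoning
  C≤C^m : C ≤ C ^ m
  C≤C^m = ≤-trans (≤-reflexive (sym (*-identityʳ C))) (^-monoʳ-≤ C (>-nonZero⁻¹ m))
  rearrange : ∀ y c n z → y * (c * (n * z)) ≡ c * y * n * z
  rearrange = solve-∀

-- The loss n^(2/m) becomes n^(2q/m) ≤ n in the q-th power.
absorb-root : ∀ q m .{{_ : NonZero m}} n .{{_ : NonZero n}} X Y → 2 * q ≤ m →
              X ^ m ≤ Y ^ m * n ^ 2 → X ^ q ≤ Y ^ q * n
absorb-root q m n X Y 2q≤m X^m≤ = ^-cancelˡ-≤ m (begin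
  (X ^ q) ^ m                 ≡⟨ ^-^-comm X q m ⟩
  (X ^ m) ^ q                 ≤⟨ ^-monoˡ-≤ q X^m≤ ⟩
  (Y ^ m * n ^ 2) ^ q         ≡⟨ ^-distrib-* (Y ^ m) (n ^ 2) q ⟩
  (Y ^ m) ^ q * (n ^ 2) ^ q   ≡⟨ cong₂ _*_ (^-^-comm Y m q) (^-*-assoc n 2 q) ⟩
  (Y ^ q) ^ m * n ^ (2 * q)   ≤⟨ *-monoʳ-≤ ((Y ^ q) ^ m) (^-monoʳ-≤ n 2q≤m) ⟩
  (Y ^ q) ^ m * n ^ m         ≡⟨ ^-distrib-* (Y ^ q) n m ⟨
  (Y ^ q * n) ^ m             ∎)
  where
  open ≤-Reasoning
  ^-^-comm : ∀ x a b → (x ^ a) ^ b ≡ (x ^ b) ^ a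
  ^-^-comm x a b = trans (^-*-assoc x a b) (trans (cong (x ^_) (*-comm a b)) (sym (^-*-assoc x b a)))

module Cases (p q : ℕ) (1≤p : 1 ≤ p) (1≤q : 1 ≤ q) where

  open ≤-Reasoning

  h = 2 * q
  m = 2 ^ h
  C = proj₁ (products-multiplicity h)
  -- 36 = 9 · 2 · 2: the 9 of the sign class, a 2 from rounding up the number of blocks, and a 2
  -- from replacing a sum by twice its larger term. The same value serves all three ranges.
  s = 36 * C

  instance
    C≢0 : NonZero C
    C≢0 = >-nonZero (proj₁ (proj₂ (products-multiplicity h)))
    m≢0 : NonZero m
    m≢0 = m^n≢0 2 h
    q≢0 : NonZero q
    q≢0 = >-nonZero 1≤q

  2q≤m : 2 * q ≤ m
  2q≤m = ≤-trans (n≤1+n h) (suc≤2^ h)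

  module _ {n ℓ : ℕ} (1<n : 1 < n) (1<ℓ : 1 < ℓ) (F : Family n) (distinct : DistinctDiffs F) where

    private
      u = unionCard F ℓ
      instance
        n≢0 : NonZero n
        n≢0 = >-nonZero (<⇒≤ 1<n)
        ℓ≢0 : NonZero ℓ
        ℓ≢0 = >-nonZero (<⇒≤ 1<ℓ)
    open Union.UnionBounds (Union.union-bounds F distinct ℓ 1<n h)

    root-^2p : ∀ {x y} → x ^ (2 * q) * n ^ (2 * p) ≤ y ^ (2 * q) → x ^ q * n ^ p ≤ y ^ q
    root-^2p {x} {y} le = ^-cancelˡ-≤ 2 (begin
      (x ^ q * n ^ p) ^ 2             ≡⟨ ^-distrib-* (x ^ q) (n ^ p) 2 ⟩
      (x ^ q) ^ 2 * (n ^ p) ^ 2       ≡⟨ cong₂ _*_ (^-2* x q) (^-2* n p) ⟨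
      x ^ (2 * q) * n ^ (2 * p)       ≤⟨ le ⟩
      y ^ (2 * q)                     ≡⟨ ^-2* y q ⟩
      (y ^ q) ^ 2                     ∎)

    n≤n^p : n ≤ n ^ p
    n≤n^p = ≤-trans (≤-reflexive (sym (*-identityʳ n))) (^-monoʳ-≤ n 1≤p)

    short : ℓ ^ (2 * q) * n ^ (2 * p) ≤ n ^ q →
            1 ^ (2 * q) * n ^ q * ℓ ^ (2 * q) ≤ u ^ (2 * q) * (s ^ (2 * q) * n ^ (2 * p))
    short hyp = begin
      1 ^ (2 * q) * n ^ q * ℓ ^ (2 * q)    ≡⟨ cong₂ _*_ (trans (cong (_* n ^ q) (^-zeroˡ (2 * q))) (*-identityˡ (n ^ q))) (sq-^ ℓ) ⟩
      n ^ q * (ℓ * ℓ) ^ q                  ≡⟨ ^-distrib-* n (ℓ * ℓ) q ⟨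
      (n * (ℓ * ℓ)) ^ q                    ≤⟨ absorb-root q m n (n * (ℓ * ℓ)) (s * s * (u * u)) 2q≤m powered ⟩
      (s * s * (u * u)) ^ q * n            ≤⟨ *-monoʳ-≤ ((s * s * (u * u)) ^ q) (≤-trans (≤-reflexive (sym (*-identityʳ n))) (^-monoʳ-≤ n (≤-trans 1≤p (m≤m+n p (p + 0))))) ⟩
      (s * s * (u * u)) ^ q * n ^ (2 * p)  ≡⟨ cong (_* n ^ (2 * p)) (trans (^-distrib-* (s * s) (u * u) q) (cong₂ _*_ (sym (sq-^ s)) (sym (sq-^ u)))) ⟩
      s ^ (2 * q) * u ^ (2 * q) * n ^ (2 * p)   ≡⟨ rearrange₀ (s ^ (2 * q)) (u ^ (2 * q)) (n ^ (2 * p)) ⟩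
      u ^ (2 * q) * (s ^ (2 * q) * n ^ (2 * p)) ∎
      where
      sq-^ : ∀ x → x ^ (2 * q) ≡ (x * x) ^ q
      sq-^ x = trans (sym (^-*-assoc x 2 q)) (cong (_^ q) (sym (m*m≡m^2 x)))
      -- What the range supplies is `ℓ ≤ n`, which keeps Z = nN within n².
      ℓ≤n : ℓ ≤ n
      ℓ≤n = ^-cancelˡ-≤ (2 * q) {{m*n≢0 2 q}} (begin
        ℓ ^ (2 * q)                 ≤⟨ m≤m*n′ _ (m^n>0 n (2 * p)) ⟩
        ℓ ^ (2 * q) * n ^ (2 * p)   ≤⟨ hyp ⟩
        n ^ q                       ≤⟨ ^-monoʳ-≤ n (m≤m+n q (q + 0)) ⟩
        n ^ (2 * q)                 ∎)
      -- The largest length allowed in `pairs`. It is positive because `1 < ℓ`, and then ℓ ≤ 2N + 1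
      -- ≤ 3N.
      N = ⌊ ℓ /2⌋
      1≤N : 1 ≤ N
      1≤N = ⌊n/2⌋-mono 1<ℓ
      ⌈⌉≤1+⌊⌋ : ∀ k → ⌈ k /2⌉ ≤ 1 + ⌊ k /2⌋
      ⌈⌉≤1+⌊⌋ zero          = z≤n
      ⌈⌉≤1+⌊⌋ (suc zero)    = ≤-refl
      ⌈⌉≤1+⌊⌋ (suc (suc k)) = s≤s (⌈⌉≤1+⌊⌋ k)
      2N≤ℓ : N + N ≤ ℓ
      2N≤ℓ = ≤-trans (+-monoʳ-≤ N (⌊n/2⌋≤⌈n/2⌉ ℓ)) (≤-reflexive (⌊n/2⌋+⌈n/2⌉≡n ℓ))
      ℓ≤3N : ℓ ≤ 3 * N
      ℓ≤3N = begin
        ℓ               ≡⟨ ⌊n/2⌋+⌈n/2⌉≡n ℓ ⟨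
        N + ⌈ ℓ /2⌉     ≤⟨ +-monoʳ-≤ N (⌈⌉≤1+⌊⌋ ℓ) ⟩
        N + (1 + N)     ≤⟨ +-monoʳ-≤ N (+-mono-≤ 1≤N (m≤m+n N 0)) ⟩
        3 * N           ∎
      rearrange₀ : ∀ a b c → a * b * c ≡ b * (a * c)
      rearrange₀ = solve-∀
      rearrange₁ : ∀ n N → n * n * (N * N * N) ≡ n * (N * N) * (n * N)
      rearrange₁ = solve-∀
      rearrange₂ : ∀ n N → n * (3 * N * (3 * N)) ≡ 9 * (n * (N * N))
      rearrange₂ = solve-∀
      rearrange₃ : ∀ C u → 9 * (C * (9 * (u * u))) ≡ 9 * 9 * C * 1 * (u * u)
      rearrange₃ = solve-∀
      rearrange₄ : ∀ C → 36 * 36 * C * C ≡ 36 * C * (36 * C)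
      rearrange₄ = solve-∀
      powered : (n * (ℓ * ℓ)) ^ m ≤ (s * s * (u * u)) ^ m * n ^ 2
      powered = begin
        (n * (ℓ * ℓ)) ^ m                              ≤⟨ ^-monoˡ-≤ m (≤-trans (*-monoʳ-≤ n (*-mono-≤ ℓ≤3N ℓ≤3N)) (≤-reflexive (rearrange₂ n N))) ⟩
        (9 * (n * (N * N))) ^ m                        ≡⟨ ^-distrib-* 9 (n * (N * N)) m ⟩
        9 ^ m * (n * (N * N)) ^ m                      ≤⟨ *-monoʳ-≤ (9 ^ m) (energy-root C m n (E N) (n * (N * N)) (9 * (u * u)) (n * N)
                                                            (*-mono-≤ (<⇒≤ 1<n) 1≤N) (*-monoʳ-≤ n (≤-trans (⌊n/2⌋≤n ℓ) ℓ≤n)) (E-bound N)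
                                                            (≤-trans (≤-reflexive (sym (rearrange₁ n N))) (pairs N 1≤N 2N≤ℓ))) ⟩
        9 ^ m * ((C * (9 * (u * u))) ^ m * n ^ 2)      ≡⟨ *-assoc (9 ^ m) _ (n ^ 2) ⟨
        9 ^ m * (C * (9 * (u * u))) ^ m * n ^ 2        ≡⟨ cong (_* n ^ 2) (^-distrib-* 9 _ m) ⟨
        (9 * (C * (9 * (u * u)))) ^ m * n ^ 2          ≡⟨ cong (λ z → z ^ m * n ^ 2) (rearrange₃ C u) ⟩
        -- One 9 comes from `ℓ ≤ 3 * N`, the other from `pairs`; 81 + 1215 = 36 * 36.
        (9 * 9 * C * 1 * (u * u)) ^ m * n ^ 2          ≤⟨ *-monoˡ-≤ (n ^ 2) (^-monoˡ-≤ m (*-monoˡ-≤ (u * u) (≤-trans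
                                                            (*-mono-≤ (*-monoˡ-≤ C (m≤m+n 81 1215)) (>-nonZero⁻¹ C)) (≤-reflexive (rearrange₄ C))))) ⟩
        (s * s * (u * u)) ^ m * n ^ 2                  ∎

    medium : ℓ ^ (2 * q) * n ^ (2 * p) ≤ n ^ (2 * q) →
             1 ^ (2 * q) * ℓ ^ (4 * q) ≤ u ^ (2 * q) * s ^ (2 * q)
    medium hyp = begin
      1 ^ (2 * q) * ℓ ^ (4 * q)    ≡⟨ trans (cong (_* ℓ ^ (4 * q)) (^-zeroˡ (2 * q))) (*-identityˡ _) ⟩
      ℓ ^ (4 * q)                  ≡⟨ trans (cong (ℓ ^_) (*-assoc 2 2 q)) (sym (^-*-assoc ℓ 2 (2 * q))) ⟩
      (ℓ ^ 2) ^ (2 * q)            ≡⟨ cong (_^ (2 * q)) (m*m≡m^2 ℓ) ⟨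
      (ℓ * ℓ) ^ (2 * q)            ≤⟨ ^-monoˡ-≤ (2 * q) ℓ²≤us ⟩
      (u * s) ^ (2 * q)            ≡⟨ ^-distrib-* u s (2 * q) ⟩
      u ^ (2 * q) * s ^ (2 * q)    ∎
      where
      ℓ^q*n≤n^q : ℓ ^ q * n ≤ n ^ q
      ℓ^q*n≤n^q = ≤-trans (*-monoʳ-≤ (ℓ ^ q) n≤n^p) (root-^2p hyp)
      -- The range gives nℓ ≤ n^(2-1/q), and (2 - 1/q)(m + 1) ≤ 2m because 2q ≤ m + 1. So the gap
      -- below n² absorbs the loss in the energy, and no power of `n` appears in the conclusion for
      -- this range. To stay in ℕ, both sides are raised to the power `q` and multiplied by
      -- `n ^ suc m`.
      [nℓ]^suc-m≤ : (n * ℓ) ^ suc m ≤ (n * n) ^ m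
      [nℓ]^suc-m≤ = ^-cancelˡ-≤ q (*-cancelʳ-≤ _ _ (n ^ suc m) {{m^n≢0 n (suc m)}} (begin
        ((n * ℓ) ^ suc m) ^ q * n ^ suc m     ≡⟨ cong (_* n ^ suc m) (trans (^-*-assoc (n * ℓ) (suc m) q) (trans (cong ((n * ℓ) ^_) (*-comm (suc m) q)) (sym (^-*-assoc (n * ℓ) q (suc m))))) ⟩
        ((n * ℓ) ^ q) ^ suc m * n ^ suc m     ≡⟨ ^-distrib-* ((n * ℓ) ^ q) n (suc m) ⟨
        ((n * ℓ) ^ q * n) ^ suc m             ≡⟨ cong (λ z → (z * n) ^ suc m) (^-distrib-* n ℓ q) ⟩
        (n ^ q * ℓ ^ q * n) ^ suc m           ≡⟨ cong (_^ suc m) (*-assoc (n ^ q) (ℓ ^ q) n) ⟩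
        (n ^ q * (ℓ ^ q * n)) ^ suc m         ≤⟨ ^-monoˡ-≤ (suc m) (*-monoʳ-≤ (n ^ q) ℓ^q*n≤n^q) ⟩
        (n ^ q * n ^ q) ^ suc m               ≡⟨ cong (_^ suc m) (^-distrib-* n n q) ⟨
        ((n * n) ^ q) ^ suc m                 ≡⟨ trans (^-*-assoc (n * n) q (suc m)) (trans (cong ((n * n) ^_) (trans (*-suc q m) (+-comm q (q * m)))) (^-distribˡ-+-* (n * n) (q * m) q)) ⟩
        (n * n) ^ (q * m) * (n * n) ^ q       ≡⟨ cong₂ _*_ (trans (cong ((n * n) ^_) (*-comm q m)) (sym (^-*-assoc (n * n) m q)))
                                                           (trans (cong (_^ q) (m*m≡m^2 n)) (^-*-assoc n 2 q)) ⟩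
        ((n * n) ^ m) ^ q * n ^ (2 * q)       ≤⟨ *-monoʳ-≤ (((n * n) ^ m) ^ q) (^-monoʳ-≤ n (m≤n⇒m≤1+n 2q≤m)) ⟩
        ((n * n) ^ m) ^ q * n ^ suc m         ∎))
      E≤ : E ℓ ≤ C * (n * n)
      E≤ = ^-cancelˡ-≤ m (begin
        E ℓ ^ m                     ≤⟨ E-bound ℓ ⟩
        C * (n * ℓ) ^ suc m         ≤⟨ *-mono-≤ (≤-trans (≤-reflexive (sym (*-identityʳ C))) (^-monoʳ-≤ C (>-nonZero⁻¹ m))) [nℓ]^suc-m≤ ⟩
        C ^ m * (n * n) ^ m         ≡⟨ ^-distrib-* C (n * n) m ⟨
        (C * (n * n)) ^ m           ∎)
      ℓ²≤us : ℓ * ℓ ≤ u * s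
      ℓ²≤us = *-cancelʳ-≤ _ _ (n * n) {{m*n≢0 n n}} (begin
        ℓ * ℓ * (n * n)                           ≡⟨ rearrange₁ ℓ n ⟩
        n * ℓ * (n * ℓ)                           ≤⟨ points ℓ 1 (≤-reflexive (sym (*-identityˡ ℓ))) ⟩
        9 * (u * (1 * (n * n + E ℓ)))             ≤⟨ *-monoʳ-≤ 9 (*-monoʳ-≤ u (*-monoʳ-≤ 1 (+-mono-≤ (m≤n*m (n * n) C) E≤))) ⟩
        9 * (u * (1 * (C * (n * n) + C * (n * n)))) ≡⟨ rearrange₂ u C n ⟩
        18 * (u * C * (n * n))                    ≤⟨ *-monoˡ-≤ (u * C * (n * n)) (m≤m+n 18 18) ⟩
        36 * (u * C * (n * n))                    ≡⟨ rearrange₃ u C n ⟩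
        u * s * (n * n)                           ∎)
        where
        rearrange₁ : ∀ ℓ n → ℓ * ℓ * (n * n) ≡ n * ℓ * (n * ℓ)
        rearrange₁ = solve-∀
        rearrange₂ : ∀ u C n → 9 * (u * (1 * (C * (n * n) + C * (n * n)))) ≡ 18 * (u * C * (n * n))
        rearrange₂ = solve-∀
        rearrange₃ : ∀ u C n → 36 * (u * C * (n * n)) ≡ u * (36 * C) * (n * n)
        rearrange₃ = solve-∀

    -- N is the minimum of n and ℓ: N ≤ n is what `energy-root` asks of Z = nN, and N ≤ ℓ ensures
    -- that rounding up the number of blocks at most doubles the length covered.
    blocks : ∃₂ λ N B → (N ≡ n ⊎ N ≡ ℓ) × 1 ≤ N × N ≤ n × ℓ ≤ B * N × B * N ≤ 2 * ℓ
    blocks with ≤-total ℓ n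
    ... | inj₁ ℓ≤n = ℓ , 1 , inj₂ refl , <⇒≤ 1<ℓ , ℓ≤n , ≤-reflexive (sym (*-identityˡ ℓ)) , *-monoˡ-≤ ℓ (n≤1+n 1)
    ... | inj₂ n≤ℓ = n , suc (ℓ / n) , inj₁ refl , <⇒≤ 1<n , ≤-refl ,
          ≤-trans (≤-reflexive (m≡m%n+[m/n]*n ℓ n)) (+-monoˡ-≤ (ℓ / n * n) (<⇒≤ (m%n<n ℓ n))) ,
          +-mono-≤ n≤ℓ (≤-trans (m/n*n≤m ℓ n) (m≤m+n ℓ 0))

    long : n ^ (2 * q) ≤ ℓ ^ (2 * q) * n ^ (2 * p) →
           1 ^ (2 * q) * n ^ (2 * q) * ℓ ^ (2 * q) ≤ u ^ (2 * q) * (s ^ (2 * q) * n ^ (2 * p))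
    long hyp = begin
      1 ^ (2 * q) * n ^ (2 * q) * ℓ ^ (2 * q)   ≡⟨ cong (_* ℓ ^ (2 * q)) (trans (cong (_* n ^ (2 * q)) (^-zeroˡ (2 * q))) (*-identityˡ (n ^ (2 * q)))) ⟩
      n ^ (2 * q) * ℓ ^ (2 * q)                 ≡⟨ trans (sym (^-distrib-* n ℓ (2 * q))) (^-2* (n * ℓ) q) ⟩
      ((n * ℓ) ^ q) ^ 2                         ≤⟨ ^-monoˡ-≤ 2 root ⟩
      ((u * s) ^ q * n ^ p) ^ 2                 ≡⟨ ^-distrib-* ((u * s) ^ q) (n ^ p) 2 ⟩
      ((u * s) ^ q) ^ 2 * (n ^ p) ^ 2           ≡⟨ cong₂ _*_ (trans (sym (^-2* (u * s) q)) (^-distrib-* u s (2 * q))) (sym (^-2* n p)) ⟩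
      u ^ (2 * q) * s ^ (2 * q) * n ^ (2 * p)   ≡⟨ *-assoc (u ^ (2 * q)) _ _ ⟩
      u ^ (2 * q) * (s ^ (2 * q) * n ^ (2 * p)) ∎
      where
      n^q≤ : n ^ q ≤ ℓ ^ q * n ^ p
      n^q≤ = ^-cancelˡ-≤ 2 (begin
        (n ^ q) ^ 2                  ≡⟨ ^-2* n q ⟨
        n ^ (2 * q)                  ≤⟨ hyp ⟩
        ℓ ^ (2 * q) * n ^ (2 * p)    ≡⟨ cong₂ _*_ (^-2* ℓ q) (^-2* n p) ⟩
        (ℓ ^ q) ^ 2 * (n ^ p) ^ 2    ≡⟨ ^-distrib-* (ℓ ^ q) (n ^ p) 2 ⟨
        (ℓ ^ q * n ^ p) ^ 2          ∎)
      36u≤us : 36 * u ≤ u * s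
      36u≤us = ≤-trans (m≤m*n (36 * u) C) (≤-reflexive (rearrange u C))
        where
        rearrange : ∀ u C → 36 * u * C ≡ u * (36 * C)
        rearrange = solve-∀
      double : ∀ u x → 18 * u * (x + x) ≡ 36 * u * x
      double = solve-∀
      counted : ∀ N B → ℓ ≤ B * N → B * N ≤ 2 * ℓ → n * n * (ℓ * N) ≤ 18 * u * (n * n + E N)
      counted N B ℓ≤BN BN≤2ℓ = *-cancelʳ-≤ _ _ ℓ (begin
        n * n * (ℓ * N) * ℓ                     ≡⟨ rearrange₁ n ℓ N ⟩
        n * ℓ * (n * ℓ) * N                     ≤⟨ *-monoˡ-≤ N (points N B ℓ≤BN) ⟩
        9 * (u * (B * (n * n + E N))) * N       ≡⟨ rearrange₂ u B (n * n + E N) N ⟩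
        9 * u * (n * n + E N) * (B * N)         ≤⟨ *-monoʳ-≤ (9 * u * (n * n + E N)) BN≤2ℓ ⟩
        9 * u * (n * n + E N) * (2 * ℓ)         ≡⟨ rearrange₃ u (n * n + E N) ℓ ⟩
        18 * u * (n * n + E N) * ℓ              ∎)
        where
        rearrange₁ : ∀ n ℓ N → n * n * (ℓ * N) * ℓ ≡ n * ℓ * (n * ℓ) * N
        rearrange₁ = solve-∀
        rearrange₂ : ∀ u B x N → 9 * (u * (B * x)) * N ≡ 9 * u * x * (B * N)
        rearrange₂ = solve-∀
        rearrange₃ : ∀ u x ℓ → 9 * u * x * (2 * ℓ) ≡ 18 * u * x * ℓ
        rearrange₃ = solve-∀
      root : (n * ℓ) ^ q ≤ (u * s) ^ q * n ^ p
      root with blocks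
      ... | N , B , N≡ , 1≤N , N≤n , ℓ≤BN , BN≤2ℓ with ≤-total (E N) (n * n)
      -- When `n * n` dominates, `N * ℓ ≤ u * s` follows. This suffices for N = n; for N = ℓ the
      -- lower end of the range replaces n by ℓ at the cost of n^ε.
      ...   | inj₁ E≤n² = few N≡
        where
        Nℓ≤us : N * ℓ ≤ u * s
        Nℓ≤us = ≤-trans (*-cancelʳ-≤ (N * ℓ) (36 * u) (n * n) {{m*n≢0 n n}} (begin
          N * ℓ * (n * n)             ≡⟨ rearrange N ℓ n ⟩
          n * n * (ℓ * N)             ≤⟨ counted N B ℓ≤BN BN≤2ℓ ⟩
          18 * u * (n * n + E N)      ≤⟨ *-monoʳ-≤ (18 * u) (+-monoʳ-≤ (n * n) E≤n²) ⟩
          18 * u * (n * n + n * n)    ≡⟨ double u (n * n) ⟩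
          36 * u * (n * n)            ∎)) 36u≤us
          where
          rearrange : ∀ N ℓ n → N * ℓ * (n * n) ≡ n * n * (ℓ * N)
          rearrange = solve-∀
        few : N ≡ n ⊎ N ≡ ℓ → (n * ℓ) ^ q ≤ (u * s) ^ q * n ^ p
        few (inj₁ refl) = ≤-trans (^-monoˡ-≤ q Nℓ≤us) (m≤m*n′ _ (m^n>0 n p))
        few (inj₂ refl) = begin
          (n * ℓ) ^ q               ≡⟨ ^-distrib-* n ℓ q ⟩
          n ^ q * ℓ ^ q             ≤⟨ *-monoˡ-≤ (ℓ ^ q) n^q≤ ⟩
          ℓ ^ q * n ^ p * ℓ ^ q     ≡⟨ rearrange (ℓ ^ q) (n ^ p) ⟩
          ℓ ^ q * ℓ ^ q * n ^ p     ≡⟨ cong (_* n ^ p) (^-distrib-* ℓ ℓ q) ⟨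
          (ℓ * ℓ) ^ q * n ^ p       ≤⟨ *-monoˡ-≤ (n ^ p) (^-monoˡ-≤ q Nℓ≤us) ⟩
          (u * s) ^ q * n ^ p       ∎
          where
          rearrange : ∀ a b → a * b * a ≡ a * a * b
          rearrange = solve-∀
      -- When the energy dominates, nℓ ≤ 36 u E / (nN), and the quotient is the loss treated by
      -- `energy-root`.
      ...   | inj₂ n²≤E = begin
        (n * ℓ) ^ q              ≤⟨ absorb-root q m n (n * ℓ) (C * (36 * u)) 2q≤m (energy-root C m n (E N) (n * ℓ) (36 * u) (n * N)
                                      (*-mono-≤ (<⇒≤ 1<n) 1≤N) (*-monoʳ-≤ n N≤n) (E-bound N) dominated) ⟩
        (C * (36 * u)) ^ q * n   ≤⟨ *-mono-≤ (^-monoˡ-≤ q (≤-reflexive (rearrange C u))) n≤n^p ⟩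
        (u * s) ^ q * n ^ p      ∎
        where
        rearrange : ∀ C u → C * (36 * u) ≡ u * (36 * C)
        rearrange = solve-∀
        dominated : n * ℓ * (n * N) ≤ 36 * u * E N
        dominated = begin
          n * ℓ * (n * N)             ≡⟨ regroup n ℓ N ⟩
          n * n * (ℓ * N)             ≤⟨ counted N B ℓ≤BN BN≤2ℓ ⟩
          18 * u * (n * n + E N)      ≤⟨ *-monoʳ-≤ (18 * u) (+-monoˡ-≤ (E N) n²≤E) ⟩
          18 * u * (E N + E N)        ≡⟨ double u (E N) ⟩
          36 * u * E N                ∎
          where
          regroup : ∀ n ℓ N → n * ℓ * (n * N) ≡ n * n * (ℓ * N)
          regroup = solve-∀

-- Here ε = p / q and c₁ = r / s. Raising to the power `2 * q` clears the denominators of 1/2 and p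
-- / q, and negative powers of `n` are moved to the other side.
theorem1 : (p q : ℕ) → 1 ≤ p → 1 ≤ q →
    Σ ℕ λ r → Σ ℕ λ s → 1 ≤ r × 1 ≤ s ×
    ((n ℓ : ℕ) → 1 < n → 1 < ℓ →
    ((ℓ ^ (2 * q) * n ^ (2 * p) ≤ n ^ q →
    uPowAtLeast ℓ n (2 * q) (s ^ (2 * q) * n ^ (2 * p)) (r ^ (2 * q) * n ^ q * ℓ ^ (2 * q)))
    × (n ^ q ≤ ℓ ^ (2 * q) * n ^ (2 * p) → ℓ ^ (2 * q) * n ^ (2 * p) ≤ n ^ (2 * q) →
    uPowAtLeast ℓ n (2 * q) (s ^ (2 * q)) (r ^ (2 * q) * ℓ ^ (4 * q)))
    × (n ^ (2 * q) ≤ ℓ ^ (2 * q) * n ^ (2 * p) →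
    uPowAtLeast ℓ n (2 * q) (s ^ (2 * q) * n ^ (2 * p)) (r ^ (2 * q) * n ^ (2 * q) * ℓ ^ (2 * q)))))
theorem1 p q 1≤p 1≤q = 1 , s , ≤-refl , *-mono-≤ {1} {36} (s≤s z≤n) (>-nonZero⁻¹ C) , λ n ℓ 1<n 1<ℓ →
  (λ hyp F distinct → short 1<n 1<ℓ F distinct hyp) ,
  (λ _ hyp F distinct → medium 1<n 1<ℓ F distinct hyp) ,
  (λ hyp F distinct → long 1<n 1<ℓ F distinct hyp)
  where open Cases p q 1≤p 1≤q
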